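{- Let $D$ and $E$ be finite sets with $|D|,|E|\ge 2$, let $P:D\times E\to\{0,1\}$ be a binary predicate, and let $0<\varepsilon<1$. (1) If there exist a two-element subset $B\subseteq D$ and a two-element subset $C\subseteq E$ such that $P|_{B\times C}$ is a singleton, then there exists an instance $I$ of $\mathrm{CSP}(P)$ such that every $\varepsilon$-sparsifier of $I$ has $\Omega(n^2)$ constraints, where $n$ is the number of variables of $I$ (i.e., there is a constant $c>0$ such that for infinitely many $n$ there is such an instance on $n$ variables with all $\varepsilon$-sparsifiers having at least $cn^2$ constraints). (2) Otherwise, for every instance $I$ of $\mathrm{CSP}(P)$ on $n$ variables there exists an $\varepsilon$-sparsifier of $I$ with $O(\varepsilon^{ -2}n)$ constraints, where the implied constant does not depend on $I$, $n$ or $\varepsilon$.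
   Context: An instance of $\mathrm{CSP}(P)$ for $P:D\times E\to\{0,1\}$ is $I=(V,\Pi,w)$ with $V$ a finite set of $n=|V|$ variables, $\Pi$ a set of constraints $\langle(u,v),P\rangle$ with $u,v\in V$ distinct, and $w:\Pi\to\mathbb{R}_{>0}$. An assignment $A:V\to D\cup E$ is valid if each variable receives a label lying in the intersection of the domains of the constraint positions it occupies: $A(u)\in D$ whenever $u$ is the first variable of some constraint and $A(v)\in E$ whenever $v$ is the second variable of some constraint. $\mathrm{Val}_I(A)=\sum_{\pi=\langle(u,v),P\rangle\in\Pi}w(\pi)P(A(u),A(v))$. An $\varepsilon$-sparsifier of $I$ is $I_\varepsilon=(V,\Pi_\varepsilon,w_\varepsilon)$ with $\Pi_\varepsilon\subseteq\Pi$, $w_\varepsilon:\Pi_\varepsilon\to\mathbb{R}_{>0}$, such that for every valid assignment $A$ of $I$, $(1-\varepsilon)\mathrm{Val}_I(A)\le\mathrm{Val}_{I_\varepsilon}(A)\le(1+\varepsilon)\mathrm{Val}_I(A)$; its number of constraints is $|\Pi_\varepsilon|$. A predicate is a singleton if exactly one tuple is mapped to $1$; $P|_{B\times C}$ is the restriction of $P$ to $B\times C$. -}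

module Defs where

open import Data.Bool.Base using (Bool; true; false; if_then_else_)
open import Data.Fin.Base using (Fin)
open import Data.Fin.Subset using (Subset; _∈_; _⊆_; _∪_; ∣_∣)
open import Data.Integer.Base using (+_)
open import Data.List.Base using (List; foldr; length)
open import Data.List.Membership.Propositional using (mapWith∈)
  renaming (_∈_ to _∈ˡ_)
open import Data.List.Relation.Binary.Subset.Propositional
  renaming (_⊆_ to _⊆ˡ_)
open import Data.List.Relation.Unary.Unique.Propositional using (Unique)
open import Data.Nat.Base as ℕ using (ℕ)
import Data.Nat.Properties as ℕ
open import Data.Product.Base using (Σ; ∃; ∃₂; _×_; _,_; proj₁; proj₂)
open import Data.Product using (∃!)
open import Data.Rational.Base as ℚ using (ℚ; 0ℚ; 1ℚ; ½; 1/_)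
import Data.Rational.Properties as ℚ
open import Data.Rational.Solver using (module +-*-Solver)
open import Function.Base using (_∘_)
open import Relation.Binary.PropositionalEquality

-- Reals are Cauchy sequences of rationals with a modulus of convergence; two
-- sequences denote the same number when each is ≤ᴿ the other.
IsCauchy : (ℕ → ℚ) → Set
IsCauchy x = ∀ δ → 0ℚ ℚ.< δ →
  ∃ λ N → ∀ m n → N ℕ.≤ m → N ℕ.≤ n → ℚ.∣ x m ℚ.- x n ∣ ℚ.< δ

record ℝ : Set where
  constructor mkℝ
  field
    seq    : ℕ → ℚ
    cauchy : IsCauchy seq

open ℝ public

infix  4 _≤ᴿ_ _<ᴿ_
infixl 6 _+ᴿ_ _-ᴿ_
infixl 7 _*ᴿ_

_≤ᴿ_ : ℝ → ℝ → Set
x ≤ᴿ y = ∀ δ → 0ℚ ℚ.< δ →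
  ∃ λ N → ∀ n → N ℕ.≤ n → seq x n ℚ.≤ seq y n ℚ.+ δ

_<ᴿ_ : ℝ → ℝ → Set
x <ᴿ y = ∃ λ δ → 0ℚ ℚ.< δ ×
  ∃ λ N → ∀ n → N ℕ.≤ n → seq x n ℚ.+ δ ℚ.≤ seq y n

private abstract
  const-cauchy : ∀ q → IsCauchy (λ _ → q)
  const-cauchy q δ 0<δ =
    0 , λ _ _ _ _ → subst (λ r → ℚ.∣ r ∣ ℚ.< δ) (sym (ℚ.+-inverseʳ q)) 0<δ

  0<½* : ∀ {δ} → 0ℚ ℚ.< δ → 0ℚ ℚ.< ½ ℚ.* δ
  0<½* {δ} 0<δ = subst (ℚ._< ½ ℚ.* δ) (ℚ.*-zeroʳ ½) (ℚ.*-monoʳ-<-pos ½ 0<δ)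

  halves : ∀ δ → ½ ℚ.* δ ℚ.+ ½ ℚ.* δ ≡ δ
  halves δ = trans (sym (ℚ.*-distribʳ-+ δ ½ ½)) (ℚ.*-identityˡ δ)

  +-cauchy : ∀ {x y} → IsCauchy x → IsCauchy y → IsCauchy (λ n → x n ℚ.+ y n)
  +-cauchy {x} {y} cx cy δ 0<δ =
    let M , hx = cx (½ ℚ.* δ) (0<½* 0<δ)
        N , hy = cy (½ ℚ.* δ) (0<½* 0<δ)
    in M ℕ.⊔ N , λ m n N≤m N≤n →
      let open ℚ.≤-Reasoning in begin-strict
      ℚ.∣ (x m ℚ.+ y m) ℚ.- (x n ℚ.+ y n) ∣
        ≡⟨ cong ℚ.∣_∣ (rearrange (x m) (y m) (x n) (y n)) ⟩
      ℚ.∣ (x m ℚ.- x n) ℚ.+ (y m ℚ.- y n) ∣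
        ≤⟨ ℚ.∣p+q∣≤∣p∣+∣q∣ (x m ℚ.- x n) (y m ℚ.- y n) ⟩
      ℚ.∣ x m ℚ.- x n ∣ ℚ.+ ℚ.∣ y m ℚ.- y n ∣
        <⟨ ℚ.+-mono-<
             (hx m n (ℕ.m⊔n≤o⇒m≤o M N N≤m) (ℕ.m⊔n≤o⇒m≤o M N N≤n))
             (hy m n (ℕ.m⊔n≤o⇒n≤o M N N≤m) (ℕ.m⊔n≤o⇒n≤o M N N≤n)) ⟩
      ½ ℚ.* δ ℚ.+ ½ ℚ.* δ
        ≡⟨ halves δ ⟩
      δ ∎
    where
    open +-*-Solver
    rearrange : ∀ a b c d →
      (a ℚ.+ b) ℚ.- (c ℚ.+ d) ≡ (a ℚ.- c) ℚ.+ (b ℚ.- d)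
    rearrange = solve 4 (λ a b c d →
      (a :+ b) :- (c :+ d) := (a :- c) :+ (b :- d)) refl

  neg-cauchy : ∀ {x} → IsCauchy x → IsCauchy (λ n → ℚ.- x n)
  neg-cauchy {x} cx δ 0<δ with N , h ← cx δ 0<δ =
    N , λ m n N≤m N≤n → subst (ℚ._< δ)
      (trans (sym (ℚ.∣-p∣≡∣p∣ (x m ℚ.- x n)))
             (cong ℚ.∣_∣ (ℚ.neg-distrib-+ (x m) (ℚ.- x n))))
      (h m n N≤m N≤n)

  bounded : ∀ {x} → IsCauchy x →
    ∃ λ B → 0ℚ ℚ.< B × ∃ λ N → ∀ n → N ℕ.≤ n → ℚ.∣ x n ∣ ℚ.≤ B
  bounded {x} cx with N , h ← cx 1ℚ (ℚ.positive⁻¹ 1ℚ) =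
    1ℚ ℚ.+ ℚ.∣ x N ∣ ,
    ℚ.+-mono-<-≤ (ℚ.positive⁻¹ 1ℚ) (ℚ.0≤∣p∣ (x N)) ,
    N , λ n N≤n →
      let open ℚ.≤-Reasoning in begin
      ℚ.∣ x n ∣                           ≡⟨ cong ℚ.∣_∣ (split (x n) (x N)) ⟩
      ℚ.∣ (x n ℚ.- x N) ℚ.+ x N ∣         ≤⟨ ℚ.∣p+q∣≤∣p∣+∣q∣ (x n ℚ.- x N) (x N) ⟩
      ℚ.∣ x n ℚ.- x N ∣ ℚ.+ ℚ.∣ x N ∣     ≤⟨ ℚ.+-monoˡ-≤ ℚ.∣ x N ∣ (ℚ.<⇒≤ (h n N N≤n ℕ.≤-refl)) ⟩
      1ℚ ℚ.+ ℚ.∣ x N ∣                    ∎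
    where
    open +-*-Solver
    split : ∀ a b → a ≡ (a ℚ.- b) ℚ.+ b
    split = solve 2 (λ a b → a := (a :- b) :+ b) refl

  divide : ∀ {B δ} → 0ℚ ℚ.< B → 0ℚ ℚ.< δ → ∃ λ η → 0ℚ ℚ.< η × B ℚ.* η ≡ δ
  divide {B} {δ} 0<B 0<δ =
    1/ B ℚ.* δ ,
    ℚ.positive⁻¹ (1/ B ℚ.* δ) {{ℚ.pos*pos⇒pos (1/ B) δ}} ,
    trans (sym (ℚ.*-assoc B (1/ B) δ))
      (trans (cong (ℚ._* δ) (ℚ.*-inverseʳ B)) (ℚ.*-identityˡ δ))
    where
    instance
      B-pos : ℚ.Positive B
      B-pos = ℚ.positive 0<B
      δ-pos : ℚ.Positive δ
      δ-pos = ℚ.positive 0<δ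
      B-nz : ℚ.NonZero B
      B-nz = ℚ.pos⇒nonZero B
      1/B-pos : ℚ.Positive (1/ B)
      1/B-pos = ℚ.1/pos⇒pos B

  ∣*∣-bound : ∀ {B η} a b → 0ℚ ℚ.< B → ℚ.∣ a ∣ ℚ.≤ B → ℚ.∣ b ∣ ℚ.< η →
    ℚ.∣ a ℚ.* b ∣ ℚ.< B ℚ.* η
  ∣*∣-bound {B} {η} a b 0<B a≤B b<η =
    let open ℚ.≤-Reasoning in begin-strict
    ℚ.∣ a ℚ.* b ∣          ≡⟨ ℚ.∣p*q∣≡∣p∣*∣q∣ a b ⟩
    ℚ.∣ a ∣ ℚ.* ℚ.∣ b ∣    ≤⟨ ℚ.*-monoʳ-≤-nonNeg ℚ.∣ b ∣ {{ℚ.nonNegative (ℚ.0≤∣p∣ b)}} a≤B ⟩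
    B ℚ.* ℚ.∣ b ∣          <⟨ ℚ.*-monoʳ-<-pos B {{ℚ.positive 0<B}} b<η ⟩
    B ℚ.* η                ∎

  *-cauchy : ∀ {x y} → IsCauchy x → IsCauchy y → IsCauchy (λ n → x n ℚ.* y n)
  *-cauchy {x} {y} cx cy δ 0<δ =
    let A , 0<A , K , x≤A = bounded cx
        B , 0<B , L , y≤B = bounded cy
        α , 0<α , Aα = divide 0<A (0<½* 0<δ)
        β , 0<β , Bβ = divide 0<B (0<½* 0<δ)
        M , hx = cx β 0<β
        N , hy = cy α 0<α
    in (K ℕ.⊔ L) ℕ.⊔ (M ℕ.⊔ N) , λ m n N≤m N≤n →
      let open ℚ.≤-Reasoning
          KL≤m = ℕ.m⊔n≤o⇒m≤o (K ℕ.⊔ L) (M ℕ.⊔ N) N≤m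
          KL≤n = ℕ.m⊔n≤o⇒m≤o (K ℕ.⊔ L) (M ℕ.⊔ N) N≤n
          MN≤m = ℕ.m⊔n≤o⇒n≤o (K ℕ.⊔ L) (M ℕ.⊔ N) N≤m
          MN≤n = ℕ.m⊔n≤o⇒n≤o (K ℕ.⊔ L) (M ℕ.⊔ N) N≤n
      in begin-strict
      ℚ.∣ x m ℚ.* y m ℚ.- x n ℚ.* y n ∣
        ≡⟨ cong ℚ.∣_∣ (rearrange (x m) (y m) (x n) (y n)) ⟩
      ℚ.∣ x m ℚ.* (y m ℚ.- y n) ℚ.+ y n ℚ.* (x m ℚ.- x n) ∣
        ≤⟨ ℚ.∣p+q∣≤∣p∣+∣q∣ (x m ℚ.* (y m ℚ.- y n)) (y n ℚ.* (x m ℚ.- x n)) ⟩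
      ℚ.∣ x m ℚ.* (y m ℚ.- y n) ∣ ℚ.+ ℚ.∣ y n ℚ.* (x m ℚ.- x n) ∣
        <⟨ ℚ.+-mono-<
             (∣*∣-bound (x m) (y m ℚ.- y n) 0<A
               (x≤A m (ℕ.m⊔n≤o⇒m≤o K L KL≤m))
               (hy m n (ℕ.m⊔n≤o⇒n≤o M N MN≤m) (ℕ.m⊔n≤o⇒n≤o M N MN≤n)))
             (∣*∣-bound (y n) (x m ℚ.- x n) 0<B
               (y≤B n (ℕ.m⊔n≤o⇒n≤o K L KL≤n))
               (hx m n (ℕ.m⊔n≤o⇒m≤o M N MN≤m) (ℕ.m⊔n≤o⇒m≤o M N MN≤n))) ⟩
      A ℚ.* α ℚ.+ B ℚ.* β
        ≡⟨ cong₂ ℚ._+_ Aα Bβ ⟩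
      ½ ℚ.* δ ℚ.+ ½ ℚ.* δ
        ≡⟨ halves δ ⟩
      δ ∎
    where
    open +-*-Solver
    open import Algebra.Properties.Ring ℚ.+-*-ring using (x[y-z]≈xy-xz)
    telescope : ∀ a b c → a ℚ.- c ≡ (a ℚ.- b) ℚ.+ (b ℚ.- c)
    telescope = solve 3 (λ a b c → a :- c := (a :- b) :+ (b :- c)) refl
    rearrange : ∀ a b c d →
      a ℚ.* b ℚ.- c ℚ.* d ≡ a ℚ.* (b ℚ.- d) ℚ.+ d ℚ.* (a ℚ.- c)
    rearrange a b c d = trans
      (telescope (a ℚ.* b) (a ℚ.* d) (c ℚ.* d))
      (cong₂ ℚ._+_
        (sym (x[y-z]≈xy-xz a b d))
        (trans (cong₂ ℚ._-_ (ℚ.*-comm a d) (ℚ.*-comm c d))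
               (sym (x[y-z]≈xy-xz d a c))))

fromℚ : ℚ → ℝ
fromℚ q = mkℝ (λ _ → q) (const-cauchy q)

fromℕ : ℕ → ℝ
fromℕ n = fromℚ (+ n ℚ./ 1)

0ᴿ 1ᴿ : ℝ
0ᴿ = fromℚ 0ℚ
1ᴿ = fromℚ 1ℚ

_+ᴿ_ _-ᴿ_ _*ᴿ_ : ℝ → ℝ → ℝ
x +ᴿ y = mkℝ (λ n → seq x n ℚ.+ seq y n)
             (+-cauchy {seq x} {seq y} (cauchy x) (cauchy y))
x -ᴿ y = mkℝ (λ n → seq x n ℚ.- seq y n)
             (+-cauchy {seq x} {λ n → ℚ.- seq y n} (cauchy x)
               (neg-cauchy {seq y} (cauchy y)))
x *ᴿ y = mkℝ (λ n → seq x n ℚ.* seq y n)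
             (*-cauchy {seq x} {seq y} (cauchy x) (cauchy y))

sumᴿ : List ℝ → ℝ
sumᴿ = foldr _+ᴿ_ 0ᴿ

-- The domains D and E of a predicate are subsets of a common finite universe,
-- so that they may overlap.
Elem : ∀ {k} → Subset k → Set
Elem D = ∃ λ x → x ∈ D

Predicate : ∀ {k} → Subset k → Subset k → Set
Predicate D E = Elem D → Elem E → Bool

module _ {k} {D E : Subset k} where

  restrict : ∀ {B C} → B ⊆ D → C ⊆ E → Predicate D E → Predicate B C
  restrict B⊆D C⊆E P (b , b∈B) (c , c∈C) = P (b , B⊆D b∈B) (c , C⊆E c∈C)

  IsSingleton : Predicate D E → Set
  IsSingleton P =
    ∃! _≡_ λ (t : Elem D × Elem E) → P (proj₁ t) (proj₂ t) ≡ true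

HasSingletonRestriction : ∀ {k} {D E : Subset k} → Predicate D E → Set
HasSingletonRestriction {D = D} {E} P =
  ∃₂ λ B C → ∃₂ λ (B⊆D : B ⊆ D) (C⊆E : C ⊆ E) →
    ∣ B ∣ ≡ 2 × ∣ C ∣ ≡ 2 × IsSingleton (restrict B⊆D C⊆E P)

-- The predicate P is fixed, so a constraint ⟨(u , v) , P⟩ is given by its scope.
Constraint : ℕ → Set
Constraint n = Fin n × Fin n

record Instance (n : ℕ) : Set where
  field
    Π        : List (Constraint n)
    unique   : Unique Π
    distinct : ∀ {u v} → (u , v) ∈ˡ Π → u ≢ v
    weight   : ∀ {c} → c ∈ˡ Π → ℝ
    weight>0 : ∀ {c} (c∈Π : c ∈ˡ Π) → 0ᴿ <ᴿ weight c∈Π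

open Instance public

#constraints : ∀ {n} → Instance n → ℕ
#constraints I = length (Π I)

module _ {k} {D E : Subset k} (P : Predicate D E) {n : ℕ} where

  Assignment : Set
  Assignment = Fin n → Elem (D ∪ E)

  Valid : Instance n → Assignment → Set
  Valid I A = ∀ {u v} → (u , v) ∈ˡ Π I → proj₁ (A u) ∈ D × proj₁ (A v) ∈ E

  Val : (I : Instance n) (A : Assignment) → Valid I A → ℝ
  Val I A valid = sumᴿ (mapWith∈ (Π I) λ {(u , v)} c∈Π →
    let Au∈D , Av∈E = valid c∈Π in
    weight I c∈Π *ᴿ
      (if P (proj₁ (A u) , Au∈D) (proj₁ (A v) , Av∈E) then 1ᴿ else 0ᴿ))

  IsSparsifier : ℝ → Instance n → Instance n → Set
  IsSparsifier ε I Iε =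
    Σ (Π Iε ⊆ˡ Π I) λ Π⊆ → ∀ A (valid : Valid I A) →
      (1ᴿ -ᴿ ε) *ᴿ Val I A valid ≤ᴿ Val Iε A (valid ∘ Π⊆) ×
      Val Iε A (valid ∘ Π⊆) ≤ᴿ (1ᴿ +ᴿ ε) *ᴿ Val I A valid

-- If P|_{B × C} is a singleton, take the complete bipartite instance: for each of
-- its constraints some assignment with labels in B and C satisfies that constraint
-- only, so no constraint can be dropped.
--
-- Otherwise the zero sets of two rows of P are equal or disjoint, so P (x , y) says
-- that x and y differ in colour for suitable colourings of D and E. Hence Val is
-- half the sum, over the colours, of cuts of a bipartite graph with two vertices
-- per variable, and it suffices to sparsify all cuts of a weighted graph. This is
-- done with the two barrier functions of Batson, Spielman and Srivastava: edges are
-- added one at a time while the weighted sum A of the chosen edges is kept between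
-- l M and u M, where M is the Laplacian and both barriers move at constant speed.
-- Real weights are first replaced by rational ones within a factor 1 + O(ε).

module Submission where

open import Algebra.Bundles using (CommutativeRing)
open import Data.Bool.Base using (Bool; true; false; not; if_then_else_)
import Data.Bool.Properties as Bool
open import Data.Empty using (⊥)
open import Data.Fin.Base using (Fin; zero; suc; _↑ˡ_; _↑ʳ_; splitAt)
open import Data.Fin.Properties as Fin
  using (_≟_; splitAt-↑ˡ; splitAt-↑ʳ; ↑ˡ-injective; ↑ʳ-injective; injective⇒≤)
open import Data.Fin.Subset as Subset using (⁅_⁆; _∪_)
open import Data.Fin.Subset.Properties
  using (_∈?_; x∈⁅x⁆; x∈⁅y⁆⇒x≡y; ∣⁅x⁆∣≡1; p⊆q⇒∣p∣≤∣q∣; ∪-identityˡ; ∪-identityʳ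
    ; x∈p∪q⁻; p⊆p∪q; q⊆p∪q)
import Data.Integer.Base as ℤ
import Data.Integer.Properties as ℤ
open import Data.List.Base
  using (List; []; _∷_; length; lookup; map; filter; allFin; cartesianProduct)
open import Data.List.Membership.Propositional using (mapWith∈)
open import Data.List.Membership.Propositional.Properties
  using (∈-lookup; ∈-map⁺; ∈-map⁻; ∈-filter⁻; ∈-allFin; ∈-cartesianProduct⁺
    ; ∈-cartesianProduct⁻)
open import Data.List.Properties using (length-++; length-map; length-tabulate)
import Data.List.Relation.Unary.All as All
open import Data.List.Relation.Unary.AllPairs using (_∷_)
open import Data.List.Relation.Unary.Any using (here; there; index; any?)
open import Data.List.Relation.Unary.Any.Properties using (lookup-index)
open import Data.List.Relation.Unary.Unique.Propositional using (Unique)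
open import Data.List.Relation.Unary.Unique.Propositional.Properties
  using (map⁺; filter⁺; allFin⁺; cartesianProduct⁺)
open import Data.Nat.Base as ℕ using (zero; suc)
import Data.Nat.Properties as ℕ
open import Data.Product.Base using (_,_; proj₁; proj₂)
import Data.Product.Properties as ×
import Data.Rational.Properties as ℚ
import Data.Rational.Unnormalised.Base as ℚᵘ
import Data.Rational.Unnormalised.Properties as ℚᵘ
open import Data.Sum.Base using (_⊎_; inj₁; inj₂; [_,_]′)
open import Data.Vec.Functional using (_++_)
open import Data.Vec.Functional.Properties using (lookup-++ˡ; lookup-++ʳ)
open import Data.Vec.Properties.WithK using ([]=-irrelevant)
open import Function.Base using (_∘_; id)
open import Relation.Binary.Definitions using (tri<; tri≈; tri>)
open import Relation.Binary.PropositionalEquality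
open import Relation.Nullary
  using (Dec; yes; no; contradiction; ¬?; _×-dec_; decidable-stable)
open import Relation.Nullary.Decidable.Core using (dec⇒maybe)
open import Tactic.RingSolver using (solve-∀)
open import Tactic.RingSolver.Core.AlmostCommutativeRing
  using (AlmostCommutativeRing; fromCommutativeRing)

open import Defs
open import Data.Fin.Subset using (Subset)
open import Data.Nat.Base using (ℕ)
open import Data.Product.Base using (Σ; ∃; _×_)
open import Relation.Nullary.Negation using (¬_)

module RationalSums where

  open import Data.Rational.Base

  ℚ-ring : AlmostCommutativeRing _ _
  ℚ-ring = fromCommutativeRing ℚ.+-*-commutativeRing (λ x → dec⇒maybe (0ℚ ℚ.≟ x))

  2ℚ : ℚ
  2ℚ = 1ℚ + 1ℚ

  0<1 : 0ℚ < 1ℚ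
  0<1 = ℚ.positive⁻¹ 1ℚ

  +-nonNeg : ∀ {x y} → 0ℚ ≤ x → 0ℚ ≤ y → 0ℚ ≤ x + y
  +-nonNeg = ℚ.+-mono-≤

  +-pos-nonNeg : ∀ {x y} → 0ℚ < x → 0ℚ ≤ y → 0ℚ < x + y
  +-pos-nonNeg = ℚ.+-mono-<-≤

  *-nonNeg : ∀ {x y} → 0ℚ ≤ x → 0ℚ ≤ y → 0ℚ ≤ x * y
  *-nonNeg {x} {y} 0≤x 0≤y = ℚ.nonNegative⁻¹ (x * y)
    {{ℚ.nonNeg*nonNeg⇒nonNeg x {{nonNegative 0≤x}} y {{nonNegative 0≤y}}}}

  *-pos : ∀ {x y} → 0ℚ < x → 0ℚ < y → 0ℚ < x * y
  *-pos {x} {y} 0<x 0<y = ℚ.positive⁻¹ (x * y)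
    {{ℚ.pos*pos⇒pos x {{positive 0<x}} y {{positive 0<y}}}}

  sq-nonNeg : ∀ x → 0ℚ ≤ x * x
  sq-nonNeg x with ℚ.≤-total 0ℚ x
  ... | inj₁ 0≤x = *-nonNeg 0≤x 0≤x
  ... | inj₂ x≤0 = ℚ.nonNegative⁻¹ (x * x)
    {{ℚ.nonPos*nonPos⇒nonPos x {{nonPositive x≤0}} x {{nonPositive x≤0}}}}

  ≤-by : ∀ {x y} p → 0ℚ ≤ p → x + p ≡ y → x ≤ y
  ≤-by {x} p 0≤p refl = subst (_≤ x + p) (ℚ.+-identityʳ x) (ℚ.+-monoʳ-≤ x 0≤p)

  <-by : ∀ {x y} p → 0ℚ < p → x + p ≡ y → x < y
  <-by {x} p 0<p refl = subst (_< x + p) (ℚ.+-identityʳ x) (ℚ.+-monoʳ-< x 0<p)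

  ≤⇒0≤- : ∀ {x y} → x ≤ y → 0ℚ ≤ y - x
  ≤⇒0≤- {x} {y} x≤y = subst (_≤ y - x) (ℚ.+-inverseʳ x) (ℚ.+-monoˡ-≤ (- x) x≤y)

  <⇒0<- : ∀ {x y} → x < y → 0ℚ < y - x
  <⇒0<- {x} {y} x<y = subst (_< y - x) (ℚ.+-inverseʳ x) (ℚ.+-monoˡ-< (- x) x<y)

  *-monoʳ : ∀ {a x y} → 0ℚ ≤ a → x ≤ y → a * x ≤ a * y
  *-monoʳ {a} 0≤a = ℚ.*-monoˡ-≤-nonNeg a {{nonNegative 0≤a}}

  *-cancelˡ-nonNeg : ∀ {a x} → 0ℚ < a → 0ℚ ≤ a * x → 0ℚ ≤ x
  *-cancelˡ-nonNeg {a} {x} 0<a h = ℚ.*-cancelˡ-≤-pos a {{positive 0<a}}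
    (subst (_≤ a * x) (sym (ℚ.*-zeroʳ a)) h)

  *-cancelˡ-pos : ∀ {a x} → 0ℚ < a → 0ℚ < a * x → 0ℚ < x
  *-cancelˡ-pos {a} {x} 0<a h = ℚ.*-cancelˡ-<-nonNeg a
    {{nonNegative (ℚ.<⇒≤ 0<a)}} (subst (_< a * x) (sym (ℚ.*-zeroʳ a)) h)

  recip : ∀ {x} → 0ℚ < x → ∃ λ i → 0ℚ < i × i * x ≡ 1ℚ
  recip {x} 0<x = (1/ x) , ℚ.positive⁻¹ _ {{ℚ.1/pos⇒pos x}} , ℚ.*-inverseˡ x
    where
    instance
      x-pos : Positive x
      x-pos = positive 0<x
      x-nz : NonZero x
      x-nz = ℚ.pos⇒nonZero x

  <⇒≱ : ∀ {x y} → x < y → ¬ (y ≤ x)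
  <⇒≱ x<y y≤x = ℚ.<-irrefl refl (ℚ.<-≤-trans x<y y≤x)

  sq≤0⇒≡0 : ∀ {x} → x * x ≤ 0ℚ → x ≡ 0ℚ
  sq≤0⇒≡0 {x} h with ℚ.<-cmp x 0ℚ
  ... | tri≈ _ x≡0 _ = x≡0
  ... | tri> _ _ 0<x = contradiction h (<⇒≱ (*-pos 0<x 0<x))
  ... | tri< x<0 _ _ = contradiction h (<⇒≱ (ℚ.positive⁻¹ (x * x)
    {{ℚ.neg*neg⇒pos x {{negative x<0}} x {{negative x<0}}}}))

  discriminant : ∀ {p b a} → 0ℚ ≤ a →
    (∀ α β → 0ℚ ≤ α * α * p - 2ℚ * (α * β) * b + β * β * a) → b * b ≤ p * a
  discriminant {p} {b} {a} 0≤a h with ℚ.<-cmp 0ℚ a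
  ... | tri> _ _ a<0 = contradiction 0≤a (<⇒≱ a<0)
  ... | tri< 0<a _ _ = ≤-by (p * a - b * b)
    (*-cancelˡ-nonNeg 0<a (subst (0ℚ ≤_) (eq p b a) (h a b))) (eq′ (p * a) (b * b))
    where
    eq : ∀ p b a → a * a * p - 2ℚ * (a * b) * b + b * b * a ≡ a * (p * a - b * b)
    eq = solve-∀ ℚ-ring
    eq′ : ∀ x y → y + (x - y) ≡ x
    eq′ = solve-∀ ℚ-ring
  ... | tri≈ _ refl _ = ≤-by (b * b * p - 2ℚ * (b * β) * b + β * β * 0ℚ) (h b β) (eq p b)
    where
    β : ℚ
    β = (p + 1ℚ) * ½
    eq : ∀ p b → b * b + (b * b * p - 2ℚ * (b * ((p + 1ℚ) * ½)) * b +
      (p + 1ℚ) * ½ * ((p + 1ℚ) * ½) * 0ℚ) ≡ p * 0ℚ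
    eq = solve-∀ ℚ-ring


  open import Algebra.Properties.Semiring.Sum
    (CommutativeRing.semiring ℚ.+-*-commutativeRing) public
    using (sum; sum-cong-≗; ∑-distrib-+; ∑-comm; *-distribˡ-sum; sum-replicate-zero)

  ∑ : ∀ {n} → (Fin n → ℚ) → ℚ
  ∑ = sum

  δ : ∀ {n} → Fin n → Fin n → ℚ
  δ zero    zero    = 1ℚ
  δ zero    (suc _) = 0ℚ
  δ (suc _) zero    = 0ℚ
  δ (suc i) (suc j) = δ i j

  ∑-zero : ∀ {n} {f : Fin n → ℚ} → (∀ i → f i ≡ 0ℚ) → ∑ f ≡ 0ℚ
  ∑-zero {n} h = trans (sum-cong-≗ h) (sum-replicate-zero n)

  ∑-δ : ∀ {n} (i : Fin n) (f : Fin n → ℚ) → ∑ (λ j → δ i j * f j) ≡ f i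
  ∑-δ zero f = trans
    (cong₂ _+_ (ℚ.*-identityˡ (f zero)) (∑-zero (λ j → ℚ.*-zeroˡ (f (suc j)))))
    (ℚ.+-identityʳ (f zero))
  ∑-δ (suc i) f = trans (cong₂ _+_ (ℚ.*-zeroˡ (f zero)) (∑-δ i (f ∘ suc)))
    (ℚ.+-identityˡ (f (suc i)))

  ∑-linear : ∀ {n} (f : Fin n → ℚ) a (g : Fin n → ℚ) → ∑ (λ i → f i + a * g i) ≡ ∑ f + a * ∑ g
  ∑-linear f a g = trans (∑-distrib-+ f (λ i → a * g i))
    (cong (∑ f +_) (sym (*-distribˡ-sum a g)))

  ∑-linear₃ : ∀ {n} (f : Fin n → ℚ) a (g : Fin n → ℚ) b (h : Fin n → ℚ) c (k : Fin n → ℚ) →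
    ∑ (λ i → f i + a * g i + b * h i + c * k i) ≡ ∑ f + a * ∑ g + b * ∑ h + c * ∑ k
  ∑-linear₃ f a g b h c k = trans (∑-linear _ c k) (cong (_+ c * ∑ k)
    (trans (∑-linear (λ i → f i + a * g i) b h) (cong (_+ b * ∑ h) (∑-linear f a g))))

  ∑-mono : ∀ {n} {f g : Fin n → ℚ} → (∀ i → f i ≤ g i) → ∑ f ≤ ∑ g
  ∑-mono {zero}  h = ℚ.≤-refl
  ∑-mono {suc n} h = ℚ.+-mono-≤ (h zero) (∑-mono (h ∘ suc))

  ∑-nonNeg : ∀ {n} {f : Fin n → ℚ} → (∀ i → 0ℚ ≤ f i) → 0ℚ ≤ ∑ f
  ∑-nonNeg {n} {f} h = subst (_≤ ∑ f) (sum-replicate-zero n) (∑-mono h)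

  term≤∑ : ∀ {n} {f : Fin n → ℚ} → (∀ i → 0ℚ ≤ f i) → ∀ i → f i ≤ ∑ f
  term≤∑ {f = f} h zero    = ≤-by (∑ (f ∘ suc)) (∑-nonNeg (h ∘ suc)) refl
  term≤∑ {f = f} h (suc i) = ℚ.≤-trans (term≤∑ (h ∘ suc) i)
    (≤-by (f zero) (h zero) (ℚ.+-comm (∑ (f ∘ suc)) (f zero)))

  ∑>0⇒∃>0 : ∀ {n} (f : Fin n → ℚ) → 0ℚ < ∑ f → ∃ λ i → 0ℚ < f i
  ∑>0⇒∃>0 {zero}  f 0<0 = contradiction 0<0 (ℚ.<-irrefl refl)
  ∑>0⇒∃>0 {suc n} f 0<∑ with 0ℚ ℚ.<? f zero
  ... | yes 0<f₀ = zero , 0<f₀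
  ... | no  f₀≤0 with i , 0<fᵢ ← ∑>0⇒∃>0 (f ∘ suc) (ℚ.<-≤-trans 0<∑
          (subst (f zero + ∑ (f ∘ suc) ≤_) (ℚ.+-identityˡ (∑ (f ∘ suc)))
            (ℚ.+-monoˡ-≤ (∑ (f ∘ suc)) (ℚ.≮⇒≥ f₀≤0)))) = suc i , 0<fᵢ

  δ-sym : ∀ {n} (i j : Fin n) → δ i j ≡ δ j i
  δ-sym zero    zero    = refl
  δ-sym zero    (suc j) = refl
  δ-sym (suc i) zero    = refl
  δ-sym (suc i) (suc j) = δ-sym i j

  ∑-δʳ : ∀ {n} (f : Fin n → ℚ) i → ∑ (λ j → f j * δ j i) ≡ f i
  ∑-δʳ f i = trans
    (sum-cong-≗ (λ j → trans (cong (f j *_) (δ-sym j i)) (ℚ.*-comm (f j) (δ i j)))) (∑-δ i f)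

  toℚ : ℕ → ℚ
  toℚ n = ℤ.+ n / 1

  toℚ-+ : ∀ a b → toℚ (a ℕ.+ b) ≡ toℚ a + toℚ b
  toℚ-+ a b = ℚ.toℚᵘ-injective (begin
    toℚᵘ (toℚ (a ℕ.+ b))            ≈⟨ ℚ.toℚᵘ-fromℚᵘ (ℚᵘ.mkℚᵘ (ℤ.+ (a ℕ.+ b)) 0) ⟩
    ℚᵘ.mkℚᵘ (ℤ.+ (a ℕ.+ b)) 0       ≈⟨ ℚᵘ.*≡* (cong (ℤ._* ℤ.+ 1) (sym (cong₂ ℤ._+_ (ℤ.*-identityʳ (ℤ.+ a)) (ℤ.*-identityʳ (ℤ.+ b))))) ⟩
    ℚᵘ.mkℚᵘ (ℤ.+ a) 0 ℚᵘ.+ ℚᵘ.mkℚᵘ (ℤ.+ b) 0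
      ≈⟨ ℚᵘ.+-cong (ℚᵘ.≃-sym (ℚ.toℚᵘ-fromℚᵘ (ℚᵘ.mkℚᵘ (ℤ.+ a) 0))) (ℚᵘ.≃-sym (ℚ.toℚᵘ-fromℚᵘ (ℚᵘ.mkℚᵘ (ℤ.+ b) 0))) ⟩
    toℚᵘ (toℚ a) ℚᵘ.+ toℚᵘ (toℚ b)  ≈⟨ ℚᵘ.≃-sym (ℚ.toℚᵘ-homo-+ (toℚ a) (toℚ b)) ⟩
    toℚᵘ (toℚ a + toℚ b)            ∎)
    where open ℚᵘ.≃-Reasoning

  toℚ-* : ∀ a b → toℚ (a ℕ.* b) ≡ toℚ a * toℚ b
  toℚ-* zero    b = sym (ℚ.*-zeroˡ (toℚ b))
  toℚ-* (suc a) b = trans (toℚ-+ b (a ℕ.* b)) (trans (cong (toℚ b +_) (toℚ-* a b))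
    (trans (r (toℚ a) (toℚ b)) (cong (_* toℚ b) (sym (toℚ-+ 1 a)))))
    where
    r : ∀ a b → b + a * b ≡ (1ℚ + a) * b
    r = solve-∀ ℚ-ring

  toℚ-nonNeg : ∀ n → 0ℚ ≤ toℚ n
  toℚ-nonNeg zero    = ℚ.≤-refl
  toℚ-nonNeg (suc n) = subst (0ℚ ≤_) (sym (toℚ-+ 1 n)) (+-nonNeg (ℚ.<⇒≤ 0<1) (toℚ-nonNeg n))

  toℚ-pos : ∀ n → 0ℚ < toℚ (suc n)
  toℚ-pos n = subst (0ℚ <_) (sym (toℚ-+ 1 n)) (+-pos-nonNeg 0<1 (toℚ-nonNeg n))

  toℚ-mono : ∀ {a b} → a ℕ.≤ b → toℚ a ≤ toℚ b
  toℚ-mono {a} {b} a≤b = ≤-by (toℚ (b ℕ.∸ a)) (toℚ-nonNeg (b ℕ.∸ a))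
    (trans (sym (toℚ-+ a (b ℕ.∸ a))) (cong toℚ (ℕ.m+[n∸m]≡n a≤b)))

  ∑-const : ∀ n c → ∑ {n} (λ _ → c) ≡ toℚ n * c
  ∑-const zero    c = sym (ℚ.*-zeroˡ c)
  ∑-const (suc n) c = trans (cong (c +_) (∑-const n c))
    (trans (r c (toℚ n)) (cong (_* c) (sym (toℚ-+ 1 n))))
    where
    r : ∀ c x → c + x * c ≡ (1ℚ + x) * c
    r = solve-∀ ℚ-ring

  δ-refl : ∀ {n} (i : Fin n) → δ i i ≡ 1ℚ
  δ-refl zero    = refl
  δ-refl (suc i) = δ-refl i

  δ-≢ : ∀ {n} {i j : Fin n} → i ≢ j → δ i j ≡ 0ℚ
  δ-≢ {i = zero}  {zero}  i≢j = contradiction refl i≢j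
  δ-≢ {i = zero}  {suc j} i≢j = refl
  δ-≢ {i = suc i} {zero}  i≢j = refl
  δ-≢ {i = suc i} {suc j} i≢j = δ-≢ (i≢j ∘ cong suc)

  δ-bit : ∀ {n} (i j : Fin n) → δ i j ≡ 0ℚ ⊎ δ i j ≡ 1ℚ
  δ-bit zero    zero    = inj₂ refl
  δ-bit zero    (suc j) = inj₁ refl
  δ-bit (suc i) zero    = inj₁ refl
  δ-bit (suc i) (suc j) = δ-bit i j

  ∑-split : ∀ n {m} (f : Fin (n ℕ.+ m) → ℚ) →
    ∑ f ≡ ∑ (λ i → f (i ↑ˡ m)) + ∑ (λ j → f (n ↑ʳ j))
  ∑-split zero    f = sym (ℚ.+-identityˡ (∑ f))
  ∑-split (suc n) f = trans (cong (f zero +_) (∑-split n (f ∘ suc))) (sym (ℚ.+-assoc (f zero) _ _))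

  ∑-swap : ∀ {m n} (A : Fin m → Fin n → ℚ) (y : Fin m → ℚ) (z : Fin n → ℚ) →
    ∑ (λ i → y i * ∑ (λ j → A i j * z j)) ≡ ∑ (λ j → ∑ (λ i → A i j * y i) * z j)
  ∑-swap A y z = trans
    (sum-cong-≗ (λ i → trans (*-distribˡ-sum (y i) (λ j → A i j * z j))
      (sum-cong-≗ (λ j → r (y i) (A i j) (z j)))))
    (trans (∑-comm (λ i j → z j * (A i j * y i)))
      (sum-cong-≗ (λ j → trans (sym (*-distribˡ-sum (z j) (λ i → A i j * y i)))
        (ℚ.*-comm (z j) (∑ (λ i → A i j * y i))))))
    where
    r : ∀ y a z → y * (a * z) ≡ z * (a * y)
    r = solve-∀ ℚ-ring

module BarrierMethod where

  open import Data.Rational.Base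
  open import Data.List.Membership.Propositional using (_∈_)
  open RationalSums

  Matrix : ℕ → Set
  Matrix m = Fin m → Fin m → ℚ

  infixr 7 _·_
  _·_ : ∀ {m} → Matrix m → (Fin m → ℚ) → Fin m → ℚ
  (G · y) i = ∑ (λ j → G i j * y j)

  quad : ∀ {m} → Matrix m → (Fin m → ℚ) → ℚ
  quad G y = ∑ (λ i → y i * (G · y) i)

  trace : ∀ {m} → (Fin m → ℚ) → Matrix m → ℚ
  trace w G = ∑ (λ i → w i * G i i)

  -- Think of rows vᵢ and of the form B = ∑ bᵢ vᵢ vᵢᵀ: then G is the matrix of the
  -- vᵢᵀ B⁻¹ vⱼ, R is the range of x ↦ (vᵢᵀ x)ᵢ, and trace b G = ν is the dimension.
  -- Neither B nor the rows are needed, only these consequences.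
  module Gram {m : ℕ} (R : (Fin m → ℚ) → Set)
    (R-comb : ∀ {y z y′} a → R y → R z → (∀ i → y′ i ≡ y i + a * z i) → R y′)
    (ν : ℚ) where

    record IsGram (b : Fin m → ℚ) (G : Matrix m) : Set where
      field
        symm : ∀ i j → G i j ≡ G j i
        psd  : ∀ y → 0ℚ ≤ quad G y
        col  : ∀ j → R (λ i → G i j)
        fix  : ∀ {y} → R y → ∀ i → (G · (λ j → b j * y j)) i ≡ y i
        rank : trace b G ≡ ν

      psd-δ : ∀ y β g → 0ℚ ≤ quad G y - 2ℚ * β * (G · y) g + β * β * G g g
      psd-δ y β g = subst (0ℚ ≤_) eq (psd z)
        where
        z : Fin m → ℚ
        z i = y i + - β * δ g i
        Gz : ∀ i → (G · z) i ≡ (G · y) i + - β * G i g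
        Gz i = trans (sum-cong-≗ (λ j → r (G i j) (y j) (- β) (δ g j)))
          (trans (∑-linear (λ j → G i j * y j) (- β) (λ j → δ g j * G i j))
            (cong (λ x → (G · y) i + - β * x) (∑-δ g (G i))))
          where
          r : ∀ a b c d → a * (b + c * d) ≡ a * b + c * (d * a)
          r = solve-∀ ℚ-ring
        eq : quad G z ≡ quad G y - 2ℚ * β * (G · y) g + β * β * G g g
        eq = trans
          (sum-cong-≗ (λ i → trans (cong (z i *_) (trans (Gz i)
              (cong (λ x → (G · y) i + - β * x) (symm i g))))
            (r (y i) (- β) (δ g i) ((G · y) i) (G g i))))
          (trans (∑-linear₃ (λ i → y i * (G · y) i) (- β) (λ i → G g i * y i)
                   (- β) (λ i → δ g i * (G · y) i) (- β * - β) (λ i → δ g i * G g i))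
            (trans (cong₂ (λ x x′ → quad G y + - β * (G · y) g + - β * x + - β * - β * x′)
                     (∑-δ g (G · y)) (∑-δ g (G g)))
              (r′ (quad G y) β ((G · y) g) (G g g))))
          where
          r : ∀ y b d p q → (y + b * d) * (p + b * q) ≡ y * p + b * (q * y) + b * (d * p) + b * b * (d * q)
          r = solve-∀ ℚ-ring
          r′ : ∀ s b p q → s + - b * p + - b * p + - b * - b * q ≡ s - 2ℚ * b * p + b * b * q
          r′ = solve-∀ ℚ-ring

      quad-δ : ∀ α g → (∀ i → (G · (λ j → α * δ g j)) i ≡ α * G g i)
                     × quad G (λ j → α * δ g j) ≡ α * α * G g g
      quad-δ α g = Gα , trans
        (sum-cong-≗ (λ i → trans (cong (α * δ g i *_) (Gα i)) (r α (δ g i) (G g i))))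
        (trans (sym (*-distribˡ-sum (α * α) (λ i → δ g i * G g i)))
          (cong (α * α *_) (∑-δ g (G g))))
        where
        r : ∀ a d q → a * d * (a * q) ≡ a * a * (d * q)
        r = solve-∀ ℚ-ring
        r′ : ∀ q a d → q * (a * d) ≡ a * (d * q)
        r′ = solve-∀ ℚ-ring
        Gα : ∀ i → (G · (λ j → α * δ g j)) i ≡ α * G g i
        Gα i = trans (sum-cong-≗ (λ j → trans (cong (_* (α * δ g j)) (symm i j)) (r′ (G j i) α (δ g j))))
          (trans (sym (*-distribˡ-sum α (λ j → δ g j * G j i)))
            (cong (α *_) (∑-δ g (λ j → G j i))))

      diag-nonNeg : ∀ i → 0ℚ ≤ G i i
      diag-nonNeg i = subst (0ℚ ≤_)
        (trans (proj₂ (quad-δ 1ℚ i)) (r (G i i))) (psd (λ j → 1ℚ * δ i j))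
        where
        r : ∀ x → 1ℚ * 1ℚ * x ≡ x
        r = solve-∀ ℚ-ring

      cauchy-schwarz : ∀ i j → G i j * G i j ≤ G i i * G j j
      cauchy-schwarz i j = discriminant (diag-nonNeg j) (λ α β → subst (0ℚ ≤_)
        (trans (cong₂ (λ x x′ → x - 2ℚ * β * x′ + β * β * G j j)
                 (proj₂ (quad-δ α i)) (proj₁ (quad-δ α i) j))
          (r α β (G i i) (G i j) (G j j)))
        (psd-δ (λ k → α * δ i k) β j))
        where
        r : ∀ α β p q s → α * α * p - 2ℚ * β * (α * q) + β * β * s
          ≡ α * α * p - 2ℚ * (α * β) * q + β * β * s
        r = solve-∀ ℚ-ring

      form-nonNeg : ∀ {y} → R y → 0ℚ ≤ ∑ (λ i → b i * (y i * y i))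
      form-nonNeg {y} Ry = subst (0ℚ ≤_)
        (sum-cong-≗ (λ i → trans (cong (b i * y i *_) (fix Ry i)) (r (b i) (y i))))
        (psd (λ i → b i * y i))
        where
        r : ∀ b y → b * y * y ≡ b * (y * y)
        r = solve-∀ ℚ-ring

    open IsGram public

    weights-≗ : ∀ {b b′ G} → (∀ i → b i ≡ b′ i) → IsGram b G → IsGram b′ G
    weights-≗ {b} {b′} {G} b≗b′ gram = record
      { symm = symm gram
      ; psd  = psd gram
      ; col  = col gram
      ; fix  = λ {y} Ry i → trans
          (sum-cong-≗ (λ j → cong (λ x → G i j * (x * y j)) (sym (b≗b′ j)))) (fix gram Ry i)
      ; rank = trans (sum-cong-≗ (λ i → cong (_* G i i) (sym (b≗b′ i)))) (rank gram)
      }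

    scale : ∀ {b G a i} → 0ℚ ≤ i → i * a ≡ 1ℚ → IsGram b G →
      IsGram (λ j → a * b j) (λ j k → i * G j k)
    scale {b} {G} {a} {i} 0≤i ia≡1 gram = record
      { symm = λ j k → cong (i *_) (symm gram j k)
      ; psd  = λ y → subst (0ℚ ≤_) (trans (*-distribˡ-sum i (λ j → y j * (G · y) j))
          (sum-cong-≗ (λ j → trans (r₁ i (y j) ((G · y) j))
            (cong (y j *_) (trans (*-distribˡ-sum i (λ k → G j k * y k))
              (sum-cong-≗ (λ k → sym (ℚ.*-assoc i (G j k) (y k)))))))))
          (*-nonNeg 0≤i (psd gram y))
      ; col  = λ k → R-comb (i - 1ℚ) (col gram k) (col gram k) (λ j → r₂ i (G j k))
      ; fix  = λ {y} Ry j → trans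
          (sum-cong-≗ (λ k → trans (r₃ i (G j k) a (b k) (y k)) (cong (_* (G j k * (b k * y k))) ia≡1)))
          (trans (sum-cong-≗ (λ k → ℚ.*-identityˡ (G j k * (b k * y k)))) (fix gram Ry j))
      ; rank = trans
          (sum-cong-≗ (λ k → trans (r₄ i (G k k) a (b k)) (cong (_* (b k * G k k)) ia≡1)))
          (trans (sum-cong-≗ (λ k → ℚ.*-identityˡ (b k * G k k))) (rank gram))
      }
      where
      r₁ : ∀ i y s → i * (y * s) ≡ y * (i * s)
      r₁ = solve-∀ ℚ-ring
      r₂ : ∀ i g → i * g ≡ g + (i - 1ℚ) * g
      r₂ = solve-∀ ℚ-ring
      r₃ : ∀ i g a b y → i * g * (a * b * y) ≡ i * a * (g * (b * y))
      r₃ = solve-∀ ℚ-ring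
      r₄ : ∀ i g a b → a * b * (i * g) ≡ i * a * (b * g)
      r₄ = solve-∀ ℚ-ring

    -- Sherman–Morrison
    update : ℚ → Fin m → Matrix m → Matrix m
    update κ g G i j = G i j - κ * (G i g * G j g)

    rank-one : ∀ {b G} → IsGram b G → ∀ g c ι → 0ℚ ≤ ι → ι * (1ℚ + c * G g g) ≡ 1ℚ →
      IsGram (λ i → b i + c * δ g i) (update (c * ι) g G)
    rank-one {b} {G} gram g c ι 0≤ι ι-eq = record
      { symm = λ i j → cong₂ (λ x x′ → x - κ * x′) (symm gram i j) (ℚ.*-comm (G i g) (G j g))
      ; psd  = λ y → subst (0ℚ ≤_) (sym (quad′ y)) (psd′ y)
      ; col  = λ j → R-comb (- κ * G j g) (col gram j) (col gram g)
          (λ i → r₁ (G i j) κ (G i g) (G j g))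
      ; fix  = fix′
      ; rank = rank′
      }
      where
      κ : ℚ
      κ = c * ι
      G′ : Matrix m
      G′ = update κ g G
      r₁ : ∀ x k p q → x - k * (p * q) ≡ x + - k * q * p
      r₁ = solve-∀ ℚ-ring

      κ-eq : c - κ - κ * c * G g g ≡ 0ℚ
      κ-eq = trans (r c ι (G g g)) (trans (cong (λ x → c - c * x) ι-eq) (r′ c))
        where
        r : ∀ c ι G → c - c * ι - c * ι * c * G ≡ c - c * (ι * (1ℚ + c * G))
        r = solve-∀ ℚ-ring
        r′ : ∀ c → c - c * 1ℚ ≡ 0ℚ
        r′ = solve-∀ ℚ-ring

      quad′ : ∀ y → quad G′ y ≡ quad G y - κ * ((G · y) g * (G · y) g)
      quad′ y = trans
        (sum-cong-≗ (λ i → trans (cong (y i *_) (trans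
            (sum-cong-≗ (λ j → trans (cong (λ x → (G i j - κ * (G i g * x)) * y j) (symm gram j g))
              (r₂ (G i j) κ (G i g) (G g j) (y j))))
            (∑-linear (λ j → G i j * y j) (- κ * G i g) (λ j → G g j * y j))))
          (trans (cong (λ x → y i * ((G · y) i + - κ * x * (G · y) g)) (symm gram i g))
            (r₃ (y i) ((G · y) i) κ (G g i) ((G · y) g)))))
        (trans (∑-linear (λ i → y i * (G · y) i) (- κ * (G · y) g) (λ i → G g i * y i))
          (r₄ (quad G y) κ ((G · y) g)))
        where
        r₂ : ∀ x k p q y → (x - k * (p * q)) * y ≡ x * y + - k * p * (q * y)
        r₂ = solve-∀ ℚ-ring
        r₃ : ∀ y s k g p → y * (s + - k * g * p) ≡ y * s + - k * p * (g * y)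
        r₃ = solve-∀ ℚ-ring
        r₄ : ∀ s k p → s + - k * p * p ≡ s - k * (p * p)
        r₄ = solve-∀ ℚ-ring

      psd′ : ∀ y → 0ℚ ≤ quad G y - κ * ((G · y) g * (G · y) g)
      psd′ y with ℚ.≤-total 0ℚ c
      ... | inj₁ 0≤c = subst (0ℚ ≤_) eq
        (+-nonNeg (psd-δ gram y (κ * p) g)
          (*-nonNeg (*-nonNeg (*-nonNeg 0≤c 0≤ι) (sq-nonNeg p)) 0≤ι))
        where
        p : ℚ
        p = (G · y) g
        ι≡ : ι ≡ 1ℚ - κ * G g g
        ι≡ = trans (r ι c (G g g)) (cong (_- κ * G g g) ι-eq)
          where
          r : ∀ i c g → i ≡ i * (1ℚ + c * g) - c * i * g
          r = solve-∀ ℚ-ring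
        eq : quad G y - 2ℚ * (κ * p) * p + κ * p * (κ * p) * G g g + κ * (p * p) * ι
          ≡ quad G y - κ * (p * p)
        eq = trans (cong (λ x → quad G y - 2ℚ * (κ * p) * p + κ * p * (κ * p) * G g g
            + κ * (p * p) * x) ι≡)
          (r (quad G y) κ p (G g g))
          where
          r : ∀ s k p g → s - 2ℚ * (k * p) * p + k * p * (k * p) * g + k * (p * p) * (1ℚ - k * g)
            ≡ s - k * (p * p)
          r = solve-∀ ℚ-ring
      ... | inj₂ c≤0 = subst (0ℚ ≤_) (r (quad G y) c ι p)
        (+-nonNeg (psd gram y) (*-nonNeg (*-nonNeg (ℚ.neg-antimono-≤ c≤0) 0≤ι) (sq-nonNeg p)))
        where
        p : ℚ
        p = (G · y) g
        r : ∀ s c i p → s + - c * i * (p * p) ≡ s - c * i * (p * p)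
        r = solve-∀ ℚ-ring

      fix′ : ∀ {y} → R y → ∀ i → (G′ · (λ j → (b j + c * δ g j) * y j)) i ≡ y i
      fix′ {y} Ry i = trans
        (sum-cong-≗ (λ j → trans
          (cong (λ x → (G i j - κ * (G i g * x)) * ((b j + c * δ g j) * y j)) (symm gram j g))
          (r (G i j) κ (G i g) (G g j) (b j) c (δ g j) (y j))))
        (trans (∑-linear₃ (λ j → G i j * (b j * y j)) (- κ * G i g) (λ j → G g j * (b j * y j))
                 c (λ j → δ g j * (G i j * y j)) (- κ * c * G i g) (λ j → δ g j * (G g j * y j)))
          (trans (cong₂ _+_ (cong₂ _+_ (cong₂ (λ x x′ → x + - κ * G i g * x′) (fix gram Ry i) (fix gram Ry g))
                     (cong (c *_) (∑-δ g (λ j → G i j * y j))))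
                     (cong (- κ * c * G i g *_) (∑-δ g (λ j → G g j * y j))))
            (trans (r′ (y i) κ (G i g) (y g) c (G g g))
              (trans (cong (λ x → y i + G i g * y g * x) κ-eq) (r″ (y i) (G i g * y g))))))
        where
        r : ∀ x k p q b c d y → (x - k * (p * q)) * ((b + c * d) * y)
          ≡ x * (b * y) + - k * p * (q * (b * y)) + c * (d * (x * y)) + - k * c * p * (d * (q * y))
        r = solve-∀ ℚ-ring
        r′ : ∀ y k p z c g → y + - k * p * z + c * (p * z) + - k * c * p * (g * z)
          ≡ y + p * z * (c - k - k * c * g)
        r′ = solve-∀ ℚ-ring
        r″ : ∀ y p → y + p * 0ℚ ≡ y
        r″ = solve-∀ ℚ-ring

      rank′ : trace (λ i → b i + c * δ g i) G′ ≡ ν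
      rank′ = trans
        (sum-cong-≗ (λ i → trans
          (cong (λ x → (b i + c * δ g i) * (G i i - κ * (x * x))) (symm gram i g))
          (r (b i) c (δ g i) (G i i) κ (G g i))))
        (trans (∑-linear₃ (λ i → b i * G i i) (- κ) (λ i → G g i * (b i * G g i))
                  c (λ i → δ g i * G i i) (- κ * c) (λ i → δ g i * (G g i * G g i)))
          (trans (cong₂ _+_ (cong₂ _+_ (cong₂ (λ x x′ → x + - κ * x′) (rank gram)
                      (trans (sum-cong-≗ (λ i → cong (λ x → G g i * (b i * x)) (symm gram g i)))
                        (fix gram (col gram g) g)))
                     (cong (c *_) (∑-δ g (λ i → G i i))))
                     (cong (- κ * c *_) (∑-δ g (λ i → G g i * G g i))))
            (trans (r′ ν κ (G g g) c)
              (trans (cong (λ x → ν + G g g * x) κ-eq) (r″ ν (G g g))))))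
        where
        r : ∀ b c d x k q → (b + c * d) * (x - k * (q * q))
          ≡ b * x + - k * (q * (b * q)) + c * (d * x) + - k * c * (d * (q * q))
        r = solve-∀ ℚ-ring
        r′ : ∀ ν k g c → ν + - k * g + c * g + - k * c * (g * g) ≡ ν + g * (c - k - k * c * g)
        r′ = solve-∀ ℚ-ring
        r″ : ∀ y p → y + p * 0ℚ ≡ y
        r″ = solve-∀ ℚ-ring

    shift-up : ∀ {b G} (x : Fin m → ℚ) → (∀ i → 0ℚ ≤ x i) → IsGram b G →
      ∃ λ G′ → IsGram (λ i → b i + x i) G′
    shift-up {b} x 0≤x gram =
      let G′ , gram′ = along id gram
      in G′ , weights-≗ (λ i → cong (b i +_) (∑-δʳ x i)) gram′
      where
      along : ∀ {n} (e : Fin n → Fin m) {b G} → IsGram b G →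
        ∃ λ G′ → IsGram (λ i → b i + ∑ (λ j → x (e j) * δ (e j) i)) G′
      along {zero} e {b} {G} gram = G , weights-≗ (λ i → sym (ℚ.+-identityʳ (b i))) gram
      along {suc n} e {b} {G} gram =
        let ι , 0<ι , ι-eq = recip (+-pos-nonNeg 0<1 (*-nonNeg (0≤x (e zero)) (diag-nonNeg gram (e zero))))
            G′ , gram′ = along (e ∘ suc) (rank-one gram (e zero) (x (e zero)) ι (ℚ.<⇒≤ 0<ι) ι-eq)
        in G′ , weights-≗ (λ i → ℚ.+-assoc (b i) (x (e zero) * δ (e zero) i)
             (∑ (λ j → x (e (suc j)) * δ (e (suc j)) i))) gram′

    shift-down : ∀ {b G} (x : Fin m → ℚ) → (∀ i → 0ℚ ≤ x i) → IsGram b G →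
      trace x G < 1ℚ → ∃ λ G′ → IsGram (λ i → b i - x i) G′
    shift-down {b} {G} x 0≤x gram h =
      let G′ , gram′ = along id gram 0<1 (λ i → ℚ.≤-reflexive (ℚ.*-identityˡ (G i i))) h
      in G′ , weights-≗ (λ i → cong (b i +_) (∑-δʳ (λ j → - x j) i)) gram′
      where
      -- Subtracting part of x lets the diagonal grow by a factor of at most 1/D,
      -- where D is 1 minus the part of trace x G used so far.
      along : ∀ {n} (e : Fin n → Fin m) {b′ G′ D} → IsGram b′ G′ → 0ℚ < D →
        (∀ i → D * G′ i i ≤ G i i) → ∑ (λ j → x (e j) * G (e j) (e j)) < D →
        ∃ λ G″ → IsGram (λ i → b′ i + ∑ (λ j → - x (e j) * δ (e j) i)) G″
      along {zero} e {b′} {G′} gram′ _ _ _ =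
        G′ , weights-≗ (λ i → sym (ℚ.+-identityʳ (b′ i))) gram′
      along {suc n} e {b′} {G′} {D} gram′ 0<D bound small =
        let ι , 0<ι , ι-eq = recip 0<1-a
            G″ , gram″ = along (e ∘ suc)
              (rank-one gram′ g (- a) ι (ℚ.<⇒≤ 0<ι) ι-eq) 0<D′ (bound′ ι (ℚ.<⇒≤ 0<ι) ι-eq)
              (<-by _ (<⇒0<- small) (r₁ (a * G g g) rest D))
        in G″ , weights-≗ (λ i → ℚ.+-assoc (b′ i) (- a * δ g i)
             (∑ (λ j → - x (e (suc j)) * δ (e (suc j)) i))) gram″
        where
        g : Fin m
        g = e zero
        a rest D′ : ℚ
        a = x g
        rest = ∑ (λ j → x (e (suc j)) * G (e (suc j)) (e (suc j)))
        D′ = D - a * G g g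
        r₁ : ∀ p q d → q + (d - (p + q)) ≡ d - p
        r₁ = solve-∀ ℚ-ring
        0<D′ : 0ℚ < D′
        0<D′ = subst (0ℚ <_) (r₂ (a * G g g) rest D)
          (+-pos-nonNeg (<⇒0<- small) (∑-nonNeg (λ j → *-nonNeg (0≤x (e (suc j))) (diag-nonNeg gram (e (suc j))))))
          where
          r₂ : ∀ p q d → d - (p + q) + q ≡ d - p
          r₂ = solve-∀ ℚ-ring
        D′≤ : D′ ≤ D * (1ℚ + - a * G′ g g)
        D′≤ = ≤-by (a * (G g g - D * G′ g g)) (*-nonNeg (0≤x g) (≤⇒0≤- (bound g)))
          (r₃ D a (G g g) (G′ g g))
          where
          r₃ : ∀ d a p q → d - a * p + a * (p - d * q) ≡ d * (1ℚ + - a * q)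
          r₃ = solve-∀ ℚ-ring
        0<1-a : 0ℚ < 1ℚ + - a * G′ g g
        0<1-a = *-cancelˡ-pos 0<D (ℚ.<-≤-trans 0<D′ D′≤)
        bound′ : ∀ ι → 0ℚ ≤ ι → ι * (1ℚ + - a * G′ g g) ≡ 1ℚ →
          ∀ i → D′ * update (- a * ι) g G′ i i ≤ G i i
        bound′ ι 0≤ι ι-eq i = ℚ.≤-trans
          (ℚ.≤-trans (*-monoʳ (ℚ.<⇒≤ 0<D′) grow)
            (ℚ.*-monoʳ-≤-nonNeg (G′ i i * ι)
              {{nonNegative (*-nonNeg (diag-nonNeg gram′ i) 0≤ι)}} D′≤))
          (ℚ.≤-trans (ℚ.≤-reflexive (trans (r₅ D (1ℚ + - a * G′ g g) (G′ i i) ι)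
            (trans (cong (D * G′ i i *_) ι-eq) (ℚ.*-identityʳ (D * G′ i i))))) (bound i))
          where
          r₅ : ∀ d z y i → d * z * (y * i) ≡ d * y * (i * z)
          r₅ = solve-∀ ℚ-ring
          ι≡ : 1ℚ + a * ι * G′ g g ≡ ι
          ι≡ = trans (cong (_+ a * ι * G′ g g) (sym ι-eq)) (r ι a (G′ g g))
            where
            r : ∀ i a y → i * (1ℚ + - a * y) + a * i * y ≡ i
            r = solve-∀ ℚ-ring
          grow : update (- a * ι) g G′ i i ≤ G′ i i * ι
          grow = subst (update (- a * ι) g G′ i i ≤_) (cong (G′ i i *_) ι≡)
            (≤-by (a * ι * (G′ i i * G′ g g - G′ i g * G′ i g))
              (*-nonNeg (*-nonNeg (0≤x g) 0≤ι) (≤⇒0≤- (cauchy-schwarz gram′ i g)))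
              (r (G′ i i) a ι (G′ i g) (G′ g g)))
            where
            r : ∀ y a i p z → y - - a * i * (p * p) + a * i * (y * z - p * p) ≡ y * (1ℚ + a * i * z)
            r = solve-∀ ℚ-ring

    module _ (w : Fin m → ℚ) where

      energy : Matrix m → Fin m → ℚ
      energy G g = ∑ (λ i → w i * (G i g * G i g))

      spread : Matrix m → ℚ
      spread G = ∑ (λ g → w g * energy G g)

      module _ (0<w : ∀ i → 0ℚ < w i) where

        private
          0≤w : ∀ i → 0ℚ ≤ w i
          0≤w i = ℚ.<⇒≤ (0<w i)

        energy-nonNeg : ∀ G g → 0ℚ ≤ energy G g
        energy-nonNeg G g = ∑-nonNeg (λ i → *-nonNeg (0≤w i) (sq-nonNeg (G i g)))

        spread-pos : 0ℚ < ν → ∀ {b G} → IsGram b G → 0ℚ < spread G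
        spread-pos 0<ν {b} {G} gram with 0ℚ ℚ.<? spread G
        ... | yes 0<s = 0<s
        ... | no  0≮s = contradiction 0<ν (ℚ.<-irrefl (trans (sym trace≡0) (rank gram)))
          where
          square≡0 : ∀ i → G i i * G i i ≤ 0ℚ
          square≡0 i = ℚ.*-cancelˡ-≤-pos (w i * w i) {{positive (*-pos (0<w i) (0<w i))}}
            (subst₂ _≤_ (sym (ℚ.*-assoc (w i) (w i) (G i i * G i i)))
              (sym (ℚ.*-zeroʳ (w i * w i)))
              (ℚ.≤-trans
                (*-monoʳ (0≤w i) (term≤∑ {f = λ j → w j * (G j i * G j i)}
                  (λ j → *-nonNeg (0≤w j) (sq-nonNeg (G j i))) i))
                (ℚ.≤-trans (term≤∑ {f = λ g → w g * energy G g}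
                  (λ g → *-nonNeg (0≤w g) (energy-nonNeg G g)) i) (ℚ.≮⇒≥ 0≮s))))
          trace≡0 : trace b G ≡ 0ℚ
          trace≡0 = ∑-zero (λ i → trans (cong (b i *_) (sq≤0⇒≡0 (square≡0 i))) (ℚ.*-zeroʳ (b i)))

        module _ {b b′ G G′ s} (gram : IsGram b G) (gram′ : IsGram b′ G′)
          (0<s : 0ℚ < s) (b′≡ : ∀ i → b′ i ≡ b i + s * w i) where

          private
            column : Matrix m → Fin m → Fin m → ℚ
            column A j i = w i * A i j

            E : Matrix m
            E i j = (G′ · column G j) i

            difference : ∀ i j → G i j ≡ G′ i j + s * E i j
            difference i j = trans (sym (fix gram′ (col gram j) i)) (trans
              (sum-cong-≗ (λ k → trans (cong (λ x → G′ i k * (x * G k j)) (b′≡ k))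
                (trans (r (G′ i k) (b k) s (w k) (G k j))
                  (cong₂ (λ x x′ → x * (b k * x′) + s * (G′ i k * (w k * G k j)))
                    (symm gram k j) (symm gram′ i k)))))
              (trans (∑-linear (λ k → G j k * (b k * G′ k i)) s (λ k → G′ i k * (w k * G k j)))
                (cong (_+ s * E i j) (trans (fix gram (col gram′ i) j) (symm gram′ j i)))))
              where
              r : ∀ g′ b s w g → g′ * ((b + s * w) * g) ≡ g * (b * g′) + s * (g′ * (w * g))
              r = solve-∀ ℚ-ring

            difference′ : ∀ i j → G i j ≡ G′ i j + s * (G · column G′ j) i
            difference′ i j = trans (symm gram i j) (trans (difference j i)
              (cong₂ (λ x y → x + s * y) (symm gram′ j i) (sum-cong-≗ (λ k → trans
                (cong₂ (λ x y → x * (w k * y)) (symm gram′ j k) (symm gram k i))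
                (r (G′ k j) (w k) (G i k))))))
              where
              r : ∀ x w y → x * (w * y) ≡ y * (w * x)
              r = solve-∀ ℚ-ring

            mixed : ∀ j → E j j ≡ energy G′ j + s * quad G (column G′ j)
            mixed j = trans
              (sum-cong-≗ (λ i → trans (cong₂ (λ x y → x * (w i * y)) (symm gram′ j i) (difference′ i j))
                (r (G′ i j) (w i) s ((G · column G′ j) i))))
              (∑-linear (λ i → w i * (G′ i j * G′ i j)) s (λ i → w i * G′ i j * (G · column G′ j) i))
              where
              r : ∀ x w s y → x * (w * (x + s * y)) ≡ w * (x * x) + s * (w * x * y)
              r = solve-∀ ℚ-ring

            mixed′ : ∀ j → energy G j ≡ E j j + s * quad G′ (column G j)
            mixed′ j = trans
              (sum-cong-≗ (λ i → trans (cong (λ x → w i * (G i j * x)) (difference i j))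
                (trans (r (w i) (G i j) (G′ i j) s (E i j))
                  (cong (λ x → x * (w i * G i j) + s * (w i * G i j * E i j)) (symm gram′ i j)))))
              (∑-linear (λ i → G′ j i * (w i * G i j)) s (λ i → w i * G i j * E i j))
              where
              r : ∀ w x y s z → w * (x * (y + s * z)) ≡ y * (w * x) + s * (w * x * z)
              r = solve-∀ ℚ-ring

          drift : ℚ
          drift = trace w E

          trace-drift : trace w G ≡ trace w G′ + s * drift
          trace-drift = trans
            (sum-cong-≗ (λ i → trans (cong (w i *_) (difference i i)) (r (w i) (G′ i i) s (E i i))))
            (∑-linear (λ i → w i * G′ i i) s (λ i → w i * E i i))
            where
            r : ∀ w x s y → w * (x + s * y) ≡ w * x + s * (w * y)
            r = solve-∀ ℚ-ring

          spread≤drift : spread G′ ≤ drift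
          spread≤drift = ∑-mono (λ j → *-monoʳ (0≤w j)
            (≤-by (s * quad G (column G′ j)) (*-nonNeg (ℚ.<⇒≤ 0<s) (psd gram (column G′ j)))
              (sym (mixed j))))

          drift-pos : 0ℚ < ν → 0ℚ < drift
          drift-pos 0<ν = ℚ.<-≤-trans (spread-pos 0<ν gram′) spread≤drift

          drift+drift²≤spread : s * trace w G′ ≤ 1ℚ → drift + s * (s * (drift * drift)) ≤ spread G
          drift+drift²≤spread small = subst (drift + s * (s * (drift * drift)) ≤_) (sym spread≡)
            (ℚ.+-monoʳ-≤ drift (*-monoʳ (ℚ.<⇒≤ 0<s) lower))
            where
            α t : ℚ
            α = ∑ (λ j → w j * quad G′ (column G j))
            t = s * drift
            spread≡ : spread G ≡ drift + s * α
            spread≡ = trans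
              (sum-cong-≗ (λ j → trans (cong (w j *_) (mixed′ j)) (r (w j) (E j j) s (quad G′ (column G j)))))
              (∑-linear (λ j → w j * E j j) s (λ j → w j * quad G′ (column G j)))
              where
              r : ∀ w x s y → w * (x + s * y) ≡ w * x + s * (w * y)
              r = solve-∀ ℚ-ring
            shifted-psd : 0ℚ ≤ α + - (2ℚ * t) * drift + t * t * trace w G′
            shifted-psd = subst (0ℚ ≤_)
              (trans (sum-cong-≗ (λ j → r (w j) (quad G′ (column G j)) t (E j j) (G′ j j)))
                (trans (∑-linear _ (t * t) (λ j → w j * G′ j j))
                  (cong (_+ t * t * trace w G′)
                    (∑-linear (λ j → w j * quad G′ (column G j)) (- (2ℚ * t)) (λ j → w j * E j j)))))
              (∑-nonNeg (λ j → *-nonNeg (0≤w j) (psd-δ gram′ (column G j) t j)))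
              where
              r : ∀ w q t e g → w * (q - 2ℚ * t * e + t * t * g)
                ≡ w * q + - (2ℚ * t) * (w * e) + t * t * (w * g)
              r = solve-∀ ℚ-ring
            lower : s * (drift * drift) ≤ α
            lower = ≤-by
              (α + - (2ℚ * t) * drift + t * t * trace w G′
                + s * (drift * drift) * (1ℚ - s * trace w G′))
              (+-nonNeg shifted-psd (*-nonNeg (*-nonNeg (ℚ.<⇒≤ 0<s) (sq-nonNeg drift)) (≤⇒0≤- small)))
              (r s drift α (trace w G′))
              where
              r : ∀ s β α τ → s * (β * β) + (α + - (2ℚ * (s * β)) * β + s * β * (s * β) * τ
                + s * (β * β) * (1ℚ - s * τ)) ≡ α
              r = solve-∀ ℚ-ring

        trace-update : ∀ κ g G → trace w (update κ g G) ≡ trace w G - κ * energy G g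
        trace-update κ g G = trans
          (sum-cong-≗ (λ i → r (w i) (G i i) κ (G i g)))
          (trans (∑-linear (λ i → w i * G i i) (- κ) (λ i → w i * (G i g * G i g)))
            (cong (trace w G +_) (sym (ℚ.neg-distribˡ-* κ (energy G g)))))
          where
          r : ∀ w x k y → w * (x - k * (y * y)) ≡ w * x + - k * (w * (y * y))
          r = solve-∀ ℚ-ring

        upper-update : ∀ {b G Δ i t} g → IsGram b G → 0ℚ ≤ Δ → i * Δ ≡ 1ℚ → 0ℚ < i → 0ℚ < t →
          t * (energy G g * i + G g g) < 1ℚ →
          ∃ λ G′ → IsGram (λ j → b j - t * δ g j) G′ × trace w G′ ≤ trace w G + Δ
        upper-update {b} {G} {Δ} {i} {t} g gram 0≤Δ iΔ≡1 0<i 0<t tU<1 =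
          let ι , 0<ι , ι-eq = recip 0<1-tG
          in update (- t * ι) g G
           , weights-≗ (λ j → r₁ (b j) t (δ g j)) (rank-one gram g (- t) ι (ℚ.<⇒≤ 0<ι) ι-eq)
           , subst (_≤ trace w G + Δ) (sym (trace-update (- t * ι) g G))
               (≤-by (ι * Δ * (1ℚ - t * (energy G g * i + G g g)))
                 (*-nonNeg (*-nonNeg (ℚ.<⇒≤ 0<ι) 0≤Δ) (ℚ.<⇒≤ (<⇒0<- tU<1)))
                 (trans (r₂ (trace w G) t ι (energy G g) Δ i (G g g))
                   (trans (cong₂ (λ x y → trace w G + Δ * x + t * ι * energy G g * (1ℚ - y)) ι-eq iΔ≡1)
                     (r₃ (trace w G) Δ (t * ι * energy G g)))))
          where
          r₁ : ∀ b t d → b + - t * d ≡ b - t * d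
          r₁ = solve-∀ ℚ-ring
          r₂ : ∀ τ t ι e Δ i g → τ - - t * ι * e + ι * Δ * (1ℚ - t * (e * i + g))
            ≡ τ + Δ * (ι * (1ℚ + - t * g)) + t * ι * e * (1ℚ - i * Δ)
          r₂ = solve-∀ ℚ-ring
          r₃ : ∀ τ Δ x → τ + Δ * 1ℚ + x * (1ℚ - 1ℚ) ≡ τ + Δ
          r₃ = solve-∀ ℚ-ring
          0<1-tG : 0ℚ < 1ℚ + - t * G g g
          0<1-tG = subst (0ℚ <_) (r t (energy G g * i) (G g g))
            (+-pos-nonNeg (<⇒0<- tU<1)
              (*-nonNeg (ℚ.<⇒≤ 0<t) (*-nonNeg (energy-nonNeg G g) (ℚ.<⇒≤ 0<i))))
            where
            r : ∀ t e g → 1ℚ - t * (e + g) + t * e ≡ 1ℚ + - t * g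
            r = solve-∀ ℚ-ring

        lower-update : ∀ {b G Δ i t} g → IsGram b G → i * Δ ≡ 1ℚ → 0ℚ < t →
          t * (energy G g * i - G g g) ≡ 1ℚ →
          ∃ λ G′ → IsGram (λ j → b j + t * δ g j) G′ × trace w G′ + Δ ≡ trace w G
        lower-update {b} {G} {Δ} {i} {t} g gram iΔ≡1 0<t tL≡1 =
          let ι , 0<ι , ι-eq = recip (+-pos-nonNeg 0<1 (*-nonNeg (ℚ.<⇒≤ 0<t) (diag-nonNeg gram g)))
              e = energy G g
          in update (t * ι) g G
           , rank-one gram g t ι (ℚ.<⇒≤ 0<ι) ι-eq
           , trans (cong (_+ Δ) (trace-update (t * ι) g G))
               (trans (r₁ (trace w G) t ι e i Δ (G g g))
                 (trans (cong₂ (λ x y → trace w G + t * ι * e * (x - 1ℚ) + Δ * (1ℚ - y)) iΔ≡1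
                     (trans (cong (λ x → ι * (x + t * G g g)) tL≡1) ι-eq))
                   (r₂ (trace w G) (t * ι * e) Δ)))
          where
          r₁ : ∀ τ t ι e i Δ g → τ - t * ι * e + Δ
            ≡ τ + t * ι * e * (i * Δ - 1ℚ) + Δ * (1ℚ - ι * (t * (e * i - g) + t * g))
          r₁ = solve-∀ ℚ-ring
          r₂ : ∀ τ x Δ → τ + x * (1ℚ - 1ℚ) + Δ * (1ℚ - 1ℚ) ≡ τ
          r₂ = solve-∀ ℚ-ring

        module BarrierShift (0<ν : 0ℚ < ν) {d r θ} (0<d : 0ℚ < d) (0<θ : 0ℚ < θ)
          (r≡ : r ≡ d + (1ℚ + 2ℚ)) (drθ≡1 : d * (r * θ) ≡ 1ℚ) where

          0<r : 0ℚ < r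
          0<r = subst (0ℚ <_) (sym r≡) (ℚ.+-mono-< 0<d (ℚ.positive⁻¹ (1ℚ + 2ℚ)))

          dθ<1 : d * θ < 1ℚ
          dθ<1 = <-by (d * θ * (d + 2ℚ))
            (*-pos (*-pos 0<d 0<θ) (ℚ.+-mono-< 0<d (ℚ.positive⁻¹ 2ℚ)))
            (trans (q d θ) (trans (cong (λ x → d * (x * θ)) (sym r≡)) drθ≡1))
            where
            q : ∀ d θ → d * θ + d * θ * (d + 2ℚ) ≡ d * ((d + (1ℚ + 2ℚ)) * θ)
            q = solve-∀ ℚ-ring

          -- On w-average the lower bound for 1/t exceeds the upper one, so some
          -- index g admits an update by t that keeps both potentials below θ.
          barrier-step : ∀ {b b′ G H} → IsGram b G → IsGram b′ H → trace w G ≤ θ → trace w H ≤ θ →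
            ∃ λ g → ∃ λ t → 0ℚ < t ×
              (∃ λ G′ → IsGram (λ i → b i + r * w i - t * δ g i) G′ × trace w G′ ≤ θ) ×
              (∃ λ H′ → IsGram (λ i → b′ i - d * w i + t * δ g i) H′ × trace w H′ ≤ θ)
          barrier-step {b} {b′} {G} {H} gramG gramH ΦG ΨH =
            let G₁ , gramG₁ = shift-up (λ i → r * w i) (λ i → *-nonNeg (ℚ.<⇒≤ 0<r) (0≤w i)) gramG
                H₁ , gramH₁ = shift-down (λ i → d * w i) (λ i → *-nonNeg (ℚ.<⇒≤ 0<d) (0≤w i)) gramH
                  (subst (_< 1ℚ) (sym trace-dw) (ℚ.≤-<-trans (*-monoʳ (ℚ.<⇒≤ 0<d) ΨH) dθ<1))
            in select gramG₁ gramH₁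
            where
            trace-dw : trace (λ i → d * w i) H ≡ d * trace w H
            trace-dw = trans (sum-cong-≗ (λ i → ℚ.*-assoc d (w i) (H i i)))
              (sym (*-distribˡ-sum d (λ i → w i * H i i)))

            select : ∀ {G₁ H₁} → IsGram (λ i → b i + r * w i) G₁ → IsGram (λ i → b′ i - d * w i) H₁ →
              ∃ λ g → ∃ λ t → 0ℚ < t ×
                (∃ λ G′ → IsGram (λ i → b i + r * w i - t * δ g i) G′ × trace w G′ ≤ θ) ×
                (∃ λ H′ → IsGram (λ i → b′ i - d * w i + t * δ g i) H′ × trace w H′ ≤ θ)
            select {G₁} {H₁} gramG₁ gramH₁ =
              let i₁ , 0<i₁ , i₁-eq = recip (*-pos 0<r 0<β₁)
                  i₂ , 0<i₂ , i₂-eq = recip (*-pos 0<d 0<β₂)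
                  g , gap = ∑>0⇒∃>0 (λ g → w g * (L i₂ g - U i₁ g)) (average i₁ 0<i₁ i₁-eq i₂ 0<i₂ i₂-eq)
                  U<L = *-cancelˡ-pos (0<w g) gap
                  0≤U = +-nonNeg (*-nonNeg (energy-nonNeg G₁ g) (ℚ.<⇒≤ 0<i₁)) (diag-nonNeg gramG₁ g)
                  t , 0<t , tL≡1 = recip (subst (0ℚ <_) (q (L i₂ g) (U i₁ g)) (+-pos-nonNeg U<L 0≤U))
                  G′ , gramG′ , ΦG′ = upper-update g gramG₁ (ℚ.<⇒≤ (*-pos 0<r 0<β₁)) i₁-eq 0<i₁ 0<t
                    (<-by (t * (L i₂ g - U i₁ g)) (*-pos 0<t U<L) (trans (q′ t (U i₁ g) (L i₂ g)) tL≡1))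
                  H′ , gramH′ , ΨH′ = lower-update g gramH₁ i₂-eq 0<t tL≡1
              in g , t , 0<t
               , (G′ , gramG′ , ℚ.≤-trans ΦG′ (subst (_≤ θ) traceG ΦG))
               , (H′ , gramH′ , subst (_≤ θ) (sym (cancel (trans ΨH′ traceH))) ΨH)
              where
              b′≡ : ∀ i → b′ i ≡ b′ i - d * w i + d * w i
              b′≡ i = q (b′ i) (d * w i)
                where
                q : ∀ x y → x ≡ x - y + y
                q = solve-∀ ℚ-ring
              β₁ β₂ : ℚ
              β₁ = drift gramG gramG₁ 0<r (λ _ → refl)
              β₂ = drift gramH₁ gramH 0<d b′≡
              0<β₁ : 0ℚ < β₁
              0<β₁ = drift-pos gramG gramG₁ 0<r (λ _ → refl) 0<ν
              0<β₂ : 0ℚ < β₂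
              0<β₂ = drift-pos gramH₁ gramH 0<d b′≡ 0<ν
              traceG : trace w G ≡ trace w G₁ + r * β₁
              traceG = trace-drift gramG gramG₁ 0<r (λ _ → refl)
              traceH : trace w H₁ ≡ trace w H + d * β₂
              traceH = trace-drift gramH₁ gramH 0<d b′≡
              spreadG : spread G₁ ≤ β₁
              spreadG = spread≤drift gramG gramG₁ 0<r (λ _ → refl)
              spreadH : β₂ + d * (d * (β₂ * β₂)) ≤ spread H₁
              spreadH = drift+drift²≤spread gramH₁ gramH 0<d b′≡
                (ℚ.≤-trans (*-monoʳ (ℚ.<⇒≤ 0<d) ΨH) (ℚ.<⇒≤ dθ<1))
              U L : ℚ → Fin m → ℚ
              U i₁ g = energy G₁ g * i₁ + G₁ g g
              L i₂ g = energy H₁ g * i₂ - H₁ g g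
              q : ∀ x y → x - y + y ≡ x
              q = solve-∀ ℚ-ring
              q′ : ∀ t x y → t * x + t * (y - x) ≡ t * y
              q′ = solve-∀ ℚ-ring
              cancel : ∀ {x y z} → x + z ≡ y + z → x ≡ y
              cancel {x} {y} {z} h = trans (p x z) (trans (cong (_- z) h) (sym (p y z)))
                where
                p : ∀ x z → x ≡ x + z - z
                p = solve-∀ ℚ-ring

              average : ∀ i₁ → 0ℚ < i₁ → i₁ * (r * β₁) ≡ 1ℚ → ∀ i₂ → 0ℚ < i₂ → i₂ * (d * β₂) ≡ 1ℚ →
                0ℚ < ∑ (λ g → w g * (L i₂ g - U i₁ g))
              average i₁ 0<i₁ i₁-eq i₂ 0<i₂ i₂-eq = subst (0ℚ <_) (sym total)
                (ℚ.<-≤-trans (+-pos-nonNeg 0<θ (+-nonNeg (≤⇒0≤- ΦG) (≤⇒0≤- ΨH)))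
                  (≤-by ((spread H₁ - (β₂ + d * (d * (β₂ * β₂)))) * i₂ + (β₁ - spread G₁) * i₁ + r * β₁)
                    (+-nonNeg (+-nonNeg
                        (*-nonNeg (≤⇒0≤- spreadH) (ℚ.<⇒≤ 0<i₂))
                        (*-nonNeg (≤⇒0≤- spreadG) (ℚ.<⇒≤ 0<i₁)))
                      (ℚ.<⇒≤ (*-pos 0<r 0<β₁)))
                    balance))
                where
                total : ∑ (λ g → w g * (L i₂ g - U i₁ g))
                  ≡ spread H₁ * i₂ - trace w H₁ - spread G₁ * i₁ - trace w G₁
                total = trans
                  (sum-cong-≗ (λ g → p (w g) (energy H₁ g) i₂ (H₁ g g) (energy G₁ g) i₁ (G₁ g g)))
                  (trans (∑-linear₃ (λ g → - 1ℚ * (w g * H₁ g g)) i₂ (λ g → w g * energy H₁ g)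
                            (- i₁) (λ g → w g * energy G₁ g) (- 1ℚ) (λ g → w g * G₁ g g))
                    (trans (cong (λ x → x + i₂ * spread H₁ + - i₁ * spread G₁ + - 1ℚ * trace w G₁)
                             (sym (*-distribˡ-sum (- 1ℚ) (λ g → w g * H₁ g g))))
                      (p′ (trace w H₁) i₂ (spread H₁) i₁ (spread G₁) (trace w G₁))))
                  where
                  p : ∀ w e i h f j g → w * (e * i - h - (f * j + g))
                    ≡ - 1ℚ * (w * h) + i * (w * e) + - j * (w * f) + - 1ℚ * (w * g)
                  p = solve-∀ ℚ-ring
                  p′ : ∀ h i s j s′ g → - 1ℚ * h + i * s + - j * s′ + - 1ℚ * g ≡ s * i - h - s′ * j - g
                  p′ = solve-∀ ℚ-ring
                1/d : β₂ * i₂ ≡ r * θ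
                1/d = trans (p β₂ i₂) (trans (cong (_* (β₂ * i₂)) (sym drθ≡1))
                  (trans (p′ d (r * θ) β₂ i₂) (trans (cong (_* (r * θ)) i₂-eq) (ℚ.*-identityˡ (r * θ)))))
                  where
                  p : ∀ β i → β * i ≡ 1ℚ * (β * i)
                  p = solve-∀ ℚ-ring
                  p′ : ∀ d x β i → d * x * (β * i) ≡ i * (d * β) * x
                  p′ = solve-∀ ℚ-ring
                1/r : β₁ * i₁ ≡ d * θ
                1/r = trans (p β₁ i₁) (trans (cong (_* (β₁ * i₁)) (sym drθ≡1))
                  (trans (p′ d r θ β₁ i₁) (trans (cong (_* (d * θ)) i₁-eq) (ℚ.*-identityˡ (d * θ)))))
                  where
                  p : ∀ β i → β * i ≡ 1ℚ * (β * i)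
                  p = solve-∀ ℚ-ring
                  p′ : ∀ d r θ β i → d * (r * θ) * (β * i) ≡ i * (r * β) * (d * θ)
                  p′ = solve-∀ ℚ-ring
                balance : θ + (θ - trace w G + (θ - trace w H))
                    + ((spread H₁ - (β₂ + d * (d * (β₂ * β₂)))) * i₂ + (β₁ - spread G₁) * i₁ + r * β₁)
                  ≡ spread H₁ * i₂ - trace w H₁ - spread G₁ * i₁ - trace w G₁
                balance = trans
                  (p θ (trace w G) (trace w H) (spread H₁) β₂ d i₂ β₁ (spread G₁) i₁ (r * β₁))
                  (trans
                    (cong₂ (λ x y → θ + (θ - trace w G + (θ - trace w H)) + spread H₁ * i₂ - x
                        - y * (d * β₂) + β₁ * i₁ - spread G₁ * i₁ + r * β₁) 1/d i₂-eq)
                    (trans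
                      (cong₂ (λ x y → θ + (θ - x + (θ - trace w H)) + spread H₁ * i₂ - r * θ
                        - 1ℚ * (d * β₂) + y - spread G₁ * i₁ + r * β₁) traceG 1/r)
                      (trans (cong (λ x → θ + (θ - (trace w G₁ + r * β₁) + (θ - trace w H)) + spread H₁ * i₂
                          - x * θ - 1ℚ * (d * β₂) + d * θ - spread G₁ * i₁ + r * β₁) r≡)
                        (trans (p′ θ (trace w G₁) (r * β₁) (trace w H) (spread H₁ * i₂) d β₂ (spread G₁ * i₁))
                          (cong (λ x → spread H₁ * i₂ - x - spread G₁ * i₁ - trace w G₁) (sym traceH))))))
                  where
                  p : ∀ θ τ τ′ s β d i β₁ s₁ i₁ rβ →
                    θ + (θ - τ + (θ - τ′)) + ((s - (β + d * (d * (β * β)))) * i + (β₁ - s₁) * i₁ + rβ)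
                    ≡ θ + (θ - τ + (θ - τ′)) + s * i - β * i - i * (d * β) * (d * β) + β₁ * i₁ - s₁ * i₁ + rβ
                  p = solve-∀ ℚ-ring
                  p′ : ∀ θ τ rβ τ′ si d β s₁ →
                    θ + (θ - (τ + rβ) + (θ - τ′)) + si - (d + (1ℚ + 2ℚ)) * θ - 1ℚ * (d * β) + d * θ - s₁ + rβ
                    ≡ si - (τ′ + d * β) - s₁ - τ
                  p′ = solve-∀ ℚ-ring

  module _ {m : ℕ} (R : (Fin m → ℚ) → Set)
    (R-comb : ∀ {y z y′} a → R y → R z → (∀ i → y′ i ≡ y i + a * z i) → R y′)
    {ν : ℚ} (0<ν : 0ℚ < ν) (w : Fin m → ℚ) (0<w : ∀ i → 0ℚ < w i)
    {d r θ u₀ : ℚ} (0<d : 0ℚ < d) (0<θ : 0ℚ < θ) (r≡ : r ≡ d + (1ℚ + 2ℚ)) (drθ≡1 : d * (r * θ) ≡ 1ℚ)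
    (0<u₀ : 0ℚ < u₀) (θu₀≡ν : θ * u₀ ≡ ν) where

    open Gram R R-comb ν
    open BarrierShift w 0<w 0<ν 0<d 0<θ r≡ drθ≡1

    record Stage (k : ℕ) : Set where
      field
        s       : Fin m → ℚ
        s≥0     : ∀ i → 0ℚ ≤ s i
        picks   : List (Fin m)
        #picks  : length picks ≡ k
        support : ∀ i → s i ≡ 0ℚ ⊎ i ∈ picks
        {G H}   : Matrix m
        upper   : IsGram (λ i → (u₀ + toℚ k * r) * w i - s i) G
        lower   : IsGram (λ i → s i - (toℚ k * d - u₀) * w i) H
        Φ≤θ     : trace w G ≤ θ
        Ψ≤θ     : trace w H ≤ θ

    stage-zero : ∀ {G₀} → IsGram w G₀ → Stage 0
    stage-zero {G₀} gram₀ =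
      let i , 0<i , iu₀≡1 = recip 0<u₀
          gram = scale (ℚ.<⇒≤ 0<i) iu₀≡1 gram₀
          trace≤θ : trace w (λ j k → i * G₀ j k) ≤ θ
          trace≤θ = ℚ.≤-reflexive (trans (trace-scale i) (trans (cong (i *_) (sym θu₀≡ν))
            (trans (p i θ u₀) (trans (cong (θ *_) iu₀≡1) (ℚ.*-identityʳ θ)))))
      in record
      { s       = λ _ → 0ℚ
      ; s≥0     = λ _ → ℚ.≤-refl
      ; picks   = []
      ; #picks  = refl
      ; support = λ _ → inj₁ refl
      ; upper   = weights-≗ (λ j → q₁ u₀ r (w j)) gram
      ; lower   = weights-≗ (λ j → q₂ u₀ d (w j)) gram
      ; Φ≤θ     = trace≤θ
      ; Ψ≤θ     = trace≤θ
      }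
      where
      trace-scale : ∀ i → trace w (λ j k → i * G₀ j k) ≡ i * ν
      trace-scale i = trans (sum-cong-≗ (λ j → p′ (w j) i (G₀ j j)))
        (trans (sym (*-distribˡ-sum i (λ j → w j * G₀ j j))) (cong (i *_) (rank gram₀)))
        where
        p′ : ∀ w i g → w * (i * g) ≡ i * (w * g)
        p′ = solve-∀ ℚ-ring
      p : ∀ i θ u → i * (θ * u) ≡ θ * (i * u)
      p = solve-∀ ℚ-ring
      q₁ : ∀ u r w → u * w ≡ (u + 0ℚ * r) * w - 0ℚ
      q₁ = solve-∀ ℚ-ring
      q₂ : ∀ u d w → u * w ≡ 0ℚ - (0ℚ * d - u) * w
      q₂ = solve-∀ ℚ-ring

    stage-suc : ∀ {k} → Stage k → Stage (suc k)
    stage-suc {k} st =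
      let g , t , 0<t , (G′ , gramG′ , ΦG′) , (H′ , gramH′ , ΨH′) =
            barrier-step (upper st) (lower st) (Φ≤θ st) (Ψ≤θ st)
      in record
      { s       = λ i → s st i + t * δ g i
      ; s≥0     = λ i → +-nonNeg (s≥0 st i) (*-nonNeg (ℚ.<⇒≤ 0<t) (δ-nonNeg g i))
      ; picks   = g ∷ picks st
      ; #picks  = cong suc (#picks st)
      ; support = λ i → support′ g t i (i ≟ g) (support st i)
      ; upper   = weights-≗ (λ i → trans (q₁ u₀ (toℚ k) r (w i) (s st i) (t * δ g i))
          (cong (λ x → (u₀ + x * r) * w i - (s st i + t * δ g i)) (sym (toℚ-+ 1 k)))) gramG′
      ; lower   = weights-≗ (λ i → trans (q₂ u₀ (toℚ k) d (w i) (s st i) (t * δ g i))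
          (cong (λ x → s st i + t * δ g i - (x * d - u₀) * w i) (sym (toℚ-+ 1 k)))) gramH′
      ; Φ≤θ     = ΦG′
      ; Ψ≤θ     = ΨH′
      }
      where
      open Stage
      δ-nonNeg : ∀ g i → 0ℚ ≤ δ g i
      δ-nonNeg g i with δ-bit {m} g i
      ... | inj₁ δ≡0 = ℚ.≤-reflexive (sym δ≡0)
      ... | inj₂ δ≡1 = subst (0ℚ ≤_) (sym δ≡1) (ℚ.<⇒≤ 0<1)
      support′ : ∀ g t i → Dec (i ≡ g) → s st i ≡ 0ℚ ⊎ i ∈ picks st →
        s st i + t * δ g i ≡ 0ℚ ⊎ i ∈ g ∷ picks st
      support′ g t i (yes i≡g) _ = inj₂ (here i≡g)
      support′ g t i (no i≢g) (inj₂ i∈) = inj₂ (there i∈)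
      support′ g t i (no i≢g) (inj₁ s≡0) =
        inj₁ (trans (cong₂ (λ x y → x + t * y) s≡0 (δ-≢ (i≢g ∘ sym))) (p t))
        where
        p : ∀ t → 0ℚ + t * 0ℚ ≡ 0ℚ
        p = solve-∀ ℚ-ring
      q₁ : ∀ u k r w s x → (u + k * r) * w - s + r * w - x ≡ (u + (1ℚ + k) * r) * w - (s + x)
      q₁ = solve-∀ ℚ-ring
      q₂ : ∀ u k d w s x → s - (k * d - u) * w - d * w + x ≡ s + x - ((1ℚ + k) * d - u) * w
      q₂ = solve-∀ ℚ-ring

    stage : ∀ {G₀} → IsGram w G₀ → ∀ k → Stage k
    stage gram₀ zero    = stage-zero gram₀
    stage gram₀ (suc k) = stage-suc (stage gram₀ k)

module CutSparsifier where

  open import Data.Rational.Base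
  open RationalSums
  open BarrierMethod
  open import Data.List.Membership.Propositional using (_∈_)

  rightParts : ∀ n {m} → List (Fin (n ℕ.+ m)) → List (Fin m)
  rightParts n []       = []
  rightParts n (i ∷ is) with splitAt n i
  ... | inj₁ _ = rightParts n is
  ... | inj₂ j = j ∷ rightParts n is

  length-rightParts : ∀ n {m} (is : List (Fin (n ℕ.+ m))) → length (rightParts n is) ℕ.≤ length is
  length-rightParts n []       = ℕ.z≤n
  length-rightParts n (i ∷ is) with splitAt n i
  ... | inj₁ _ = ℕ.m≤n⇒m≤1+n (length-rightParts n is)
  ... | inj₂ _ = ℕ.s≤s (length-rightParts n is)

  ∈-rightParts : ∀ n {m} {j : Fin m} {is} → n ↑ʳ j ∈ is → j ∈ rightParts n is
  ∈-rightParts n {m} {j} (here refl) rewrite splitAt-↑ʳ n m j = here refl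
  ∈-rightParts n {is = i ∷ is} (there j∈) with splitAt n i
  ... | inj₁ _ = ∈-rightParts n j∈
  ... | inj₂ _ = there (∈-rightParts n j∈)

  IsBit : ℚ → Set
  IsBit x = x ≡ 0ℚ ⊎ x ≡ 1ℚ

  bit-idem : ∀ {x} → IsBit x → x * x ≡ x
  bit-idem (inj₁ refl) = refl
  bit-idem (inj₂ refl) = refl

  bit≤1 : ∀ {x} → IsBit x → x ≤ 1ℚ
  bit≤1 (inj₁ refl) = ℚ.<⇒≤ 0<1
  bit≤1 (inj₂ refl) = ℚ.≤-refl

  bits-apart : ∀ {x y} → IsBit x → IsBit y → IsBit ((x - y) * (x - y))
  bits-apart (inj₁ refl) (inj₁ refl) = inj₁ refl
  bits-apart (inj₁ refl) (inj₂ refl) = inj₂ refl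
  bits-apart (inj₂ refl) (inj₁ refl) = inj₂ refl
  bits-apart (inj₂ refl) (inj₂ refl) = inj₁ refl

  -- The unit vectors are adjoined to the edges as rows of unit weight, which makes
  -- the Laplacian invertible.
  module Laplacian {N m : ℕ} (src tgt : Fin m → Fin N) where

    edge : Fin m → Fin N → ℚ
    edge j i = δ (src j) i - δ (tgt j) i

    V : Fin (N ℕ.+ m) → Fin N → ℚ
    V = δ ++ edge

    dot : (Fin N → ℚ) → Fin (N ℕ.+ m) → ℚ
    dot x e = ∑ (λ i → V e i * x i)

    dot-vertex : ∀ x i → dot x (i ↑ˡ m) ≡ x i
    dot-vertex x i = trans
      (sum-cong-≗ (λ j → cong (λ v → v j * x j) (lookup-++ˡ δ edge i))) (∑-δ i x)

    dot-edge : ∀ x j → dot x (N ↑ʳ j) ≡ x (src j) - x (tgt j)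
    dot-edge x j = trans
      (sum-cong-≗ (λ i → trans (cong (λ v → v i * x i) (lookup-++ʳ δ edge j))
        (q (δ (src j) i) (δ (tgt j) i) (x i))))
      (trans (∑-linear (λ i → δ (src j) i * x i) (- 1ℚ) (λ i → δ (tgt j) i * x i))
        (trans (cong₂ (λ y z → y + - 1ℚ * z) (∑-δ (src j) x) (∑-δ (tgt j) x))
          (q′ (x (src j)) (x (tgt j)))))
      where
      q : ∀ a b x → (a - b) * x ≡ a * x + - 1ℚ * (b * x)
      q = solve-∀ ℚ-ring
      q′ : ∀ x y → x + - 1ℚ * y ≡ x - y
      q′ = solve-∀ ℚ-ring

    Range : (Fin (N ℕ.+ m) → ℚ) → Set
    Range y = ∃ λ x → ∀ e → y e ≡ dot x e

    Range-comb : ∀ {y z y′} a → Range y → Range z → (∀ i → y′ i ≡ y i + a * z i) → Range y′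
    Range-comb a (x , y≡) (x′ , z≡) y′≡ = (λ i → x i + a * x′ i) , λ e →
      trans (y′≡ e) (trans (cong₂ (λ p q → p + a * q) (y≡ e) (z≡ e))
        (trans (sym (∑-linear (λ i → V e i * x i) a (λ i → V e i * x′ i)))
          (sum-cong-≗ (λ i → q (V e i) (x i) a (x′ i)))))
      where
      q : ∀ v x a y → v * x + a * (v * y) ≡ v * (x + a * y)
      q = solve-∀ ℚ-ring

    open Gram Range Range-comb (toℚ N)

    unit-weights : Fin (N ℕ.+ m) → ℚ
    unit-weights = (λ (_ : Fin N) → 1ℚ) ++ (λ _ → 0ℚ)

    inner-gram : IsGram unit-weights (λ e f → dot (V f) e)
    inner-gram = record
      { symm = λ e f → sum-cong-≗ (λ i → ℚ.*-comm (V e i) (V f i))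
      ; psd  = λ y → subst (0ℚ ≤_) (sym (quad≡ y)) (∑-nonNeg (λ i → sq-nonNeg (mean y i)))
      ; col  = λ f → V f , λ _ → refl
      ; fix  = fix′
      ; rank = trans (∑-split N (λ e → unit-weights e * dot (V e) e))
          (trans (cong₂ _+_
              (trans (sum-cong-≗ (λ i → trans
                  (cong₂ _*_ (weight-vertex i) (trans (dot-vertex (V (i ↑ˡ m)) i)
                    (trans (cong (λ v → v i) (lookup-++ˡ δ edge i)) (δ-refl i)))) refl))
                (∑-const N 1ℚ))
              (∑-zero (λ j → trans (cong (_* dot (V (N ↑ʳ j)) (N ↑ʳ j)) (weight-edge j))
                (ℚ.*-zeroˡ (dot (V (N ↑ʳ j)) (N ↑ʳ j))))))
            (q (toℚ N)))
      }
      where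
      weight-vertex : ∀ i → unit-weights (i ↑ˡ m) ≡ 1ℚ
      weight-vertex i = lookup-++ˡ (λ (_ : Fin N) → 1ℚ) (λ _ → 0ℚ) i
      weight-edge : ∀ j → unit-weights (N ↑ʳ j) ≡ 0ℚ
      weight-edge j = lookup-++ʳ (λ (_ : Fin N) → 1ℚ) (λ _ → 0ℚ) j
      q : ∀ x → x * 1ℚ + 0ℚ ≡ x
      q = solve-∀ ℚ-ring
      mean : (Fin (N ℕ.+ m) → ℚ) → Fin N → ℚ
      mean y i = ∑ (λ e → V e i * y e)
      product≡ : ∀ y e → ∑ (λ f → dot (V f) e * y f) ≡ ∑ (λ i → V e i * mean y i)
      product≡ y e = trans
        (sum-cong-≗ (λ f → trans (ℚ.*-comm (dot (V f) e) (y f))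
          (cong (y f *_) (sum-cong-≗ (λ i → ℚ.*-comm (V e i) (V f i))))))
        (trans (∑-swap V y (V e)) (sum-cong-≗ (λ i → ℚ.*-comm (mean y i) (V e i))))
      quad≡ : ∀ y → quad (λ e f → dot (V f) e) y ≡ ∑ (λ i → mean y i * mean y i)
      quad≡ y = trans (sum-cong-≗ (λ e → cong (y e *_) (product≡ y e))) (∑-swap V y (mean y))
      fix′ : ∀ {y} → Range y → ∀ e → ∑ (λ f → dot (V f) e * (unit-weights f * y f)) ≡ y e
      fix′ {y} (x , y≡) e = trans
        (∑-split N (λ f → dot (V f) e * (unit-weights f * y f)))
        (trans (cong₂ _+_
            (sum-cong-≗ (λ i → trans
              (cong₂ _*_
                (trans (sum-cong-≗ (λ k → trans (cong (λ v → V e k * v k) (lookup-++ˡ δ edge i))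
                    (ℚ.*-comm (V e k) (δ i k)))) (∑-δ i (V e)))
                (cong₂ _*_ (weight-vertex i) (trans (y≡ (i ↑ˡ m)) (dot-vertex x i))))
              (cong (V e i *_) (ℚ.*-identityˡ (x i)))))
            (∑-zero (λ j → trans (cong (λ b → dot (V (N ↑ʳ j)) e * (b * y (N ↑ʳ j))) (weight-edge j))
              (q′ (dot (V (N ↑ʳ j)) e) (y (N ↑ʳ j))))))
          (trans (ℚ.+-identityʳ (dot x e)) (sym (y≡ e))))
        where
        q′ : ∀ g y → g * (0ℚ * y) ≡ 0ℚ
        q′ = solve-∀ ℚ-ring

    apart : (Fin N → ℚ) → Fin m → ℚ
    apart x j = (x (src j) - x (tgt j)) * (x (src j) - x (tgt j))

    cut : (Fin m → ℚ) → (Fin N → ℚ) → ℚ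
    cut w x = ∑ (λ j → w j * apart x j)

    cut-dichotomy : ∀ {Λ} w → (∀ j → 0ℚ < w j) → (∀ j → Λ ≤ w j) → ∀ x → (∀ i → IsBit (x i)) →
      (∀ j → apart x j ≡ 0ℚ) ⊎ Λ ≤ cut w x
    cut-dichotomy {Λ} w 0<w Λ≤w x bits with 0ℚ ℚ.<? cut w x
    ... | yes 0<cut = inj₂ (large (∑>0⇒∃>0 (λ j → w j * apart x j) 0<cut))
      where
      large : (∃ λ j → 0ℚ < w j * apart x j) → Λ ≤ cut w x
      large (j , 0<term) with bits-apart (bits (src j)) (bits (tgt j))
      ... | inj₁ apart≡0 = contradiction 0<term
        (ℚ.<-irrefl (sym (trans (cong (w j *_) apart≡0) (ℚ.*-zeroʳ (w j)))))
      ... | inj₂ apart≡1 = ℚ.≤-trans (Λ≤w j) (subst (_≤ cut w x)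
        (trans (cong (w j *_) apart≡1) (ℚ.*-identityʳ (w j)))
        (term≤∑ {f = λ j → w j * apart x j}
          (λ j → *-nonNeg (ℚ.<⇒≤ (0<w j)) (sq-nonNeg (x (src j) - x (tgt j)))) j))
    ... | no 0≮cut = inj₁ (λ j → ℚ.≤-antisym
      (ℚ.*-cancelˡ-≤-pos (w j) {{positive (0<w j)}} (subst (w j * apart x j ≤_) (sym (ℚ.*-zeroʳ (w j)))
        (ℚ.≤-trans (term≤∑ {f = λ j → w j * apart x j}
          (λ j → *-nonNeg (ℚ.<⇒≤ (0<w j)) (sq-nonNeg (x (src j) - x (tgt j)))) j) (ℚ.≮⇒≥ 0≮cut))))
      (sq-nonNeg (x (src j) - x (tgt j))))

    record Sparsified (w : Fin m → ℚ) (T : ℕ) (lo mid hi : ℚ) : Set where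
      field
        s       : Fin m → ℚ
        s≥0     : ∀ j → 0ℚ ≤ s j
        picks   : List (Fin m)
        #picks  : length picks ℕ.≤ T
        support : ∀ j → s j ≡ 0ℚ ⊎ j ∈ picks
        above   : ∀ x → (∀ i → IsBit (x i)) → lo * cut w x ≤ mid * cut s x
        below   : ∀ x → (∀ i → IsBit (x i)) → mid * cut s x ≤ hi * cut w x

    -- A nonempty cut is assumed to outweigh all the unit rows together.
    module Heavy (0<N : 0ℚ < toℚ N) (d′ : ℕ) (w : Fin m → ℚ) (0<w : ∀ j → 0ℚ < w j)
      (heavy : ∀ j → toℚ N * (toℚ (suc d′) + (2ℚ + 2ℚ)) ≤ w j) where

      T : ℕ
      T = N ℕ.* (suc d′ ℕ.* (suc d′ ℕ.+ 3))

      private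
        d r Z : ℚ
        d = toℚ (suc d′)
        r = d + (1ℚ + 2ℚ)
        Z = toℚ N * (d * r)

        0<d : 0ℚ < d
        0<d = toℚ-pos d′

        0<r : 0ℚ < r
        0<r = ℚ.+-mono-< 0<d (ℚ.positive⁻¹ (1ℚ + 2ℚ))

      0<Z : 0ℚ < Z
      0<Z = *-pos 0<N (*-pos 0<d 0<r)

      private
        T≡Z : toℚ T ≡ Z
        T≡Z = trans (toℚ-* N _) (cong (toℚ N *_) (trans (toℚ-* (suc d′) (suc d′ ℕ.+ 3))
          (cong (d *_) (toℚ-+ (suc d′) 3))))

        ŵ : Fin (N ℕ.+ m) → ℚ
        ŵ = (λ (_ : Fin N) → 1ℚ) ++ w

        0<ŵ : ∀ e → 0ℚ < ŵ e
        0<ŵ e with splitAt N e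
        ... | inj₁ _ = 0<1
        ... | inj₂ j = 0<w j

        full-gram : ∃ λ G → IsGram ŵ G
        full-gram =
          let G , gram = shift-up ((λ (_ : Fin N) → 0ℚ) ++ w) nonNeg′ inner-gram
          in G , weights-≗ total gram
          where
          nonNeg′ : ∀ e → 0ℚ ≤ ((λ (_ : Fin N) → 0ℚ) ++ w) e
          nonNeg′ e with splitAt N e
          ... | inj₁ _ = ℚ.≤-refl
          ... | inj₂ j = ℚ.<⇒≤ (0<w j)
          total : ∀ e → unit-weights e + ((λ (_ : Fin N) → 0ℚ) ++ w) e ≡ ŵ e
          total e with splitAt N e
          ... | inj₁ _ = refl
          ... | inj₂ j = ℚ.+-identityˡ (w j)

      sparsified : Sparsified w T (Z * (d - 2ℚ)) 1ℚ (Z * (d + (1ℚ + 2ℚ + 2ℚ)))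
      sparsified =
        let θ , 0<θ , θdr≡1 = recip (*-pos 0<d 0<r)
            st = stage Range Range-comb 0<N ŵ 0<ŵ 0<d 0<θ refl
              (trans (q₁ d r θ) θdr≡1) 0<Z
              (trans (q₂ θ (toℚ N) (d * r)) (trans (cong (toℚ N *_) θdr≡1) (ℚ.*-identityʳ (toℚ N))))
              (proj₂ full-gram) T
        in extract (Stage.s st) (Stage.s≥0 st) (Stage.picks st) (Stage.#picks st) (Stage.support st)
             (weights-≗ (λ e → cong (λ t → (Z + t * r) * ŵ e - Stage.s st e) T≡Z) (Stage.upper st))
             (weights-≗ (λ e → cong (λ t → Stage.s st e - (t * d - Z) * ŵ e) T≡Z) (Stage.lower st))
        where
        q₁ : ∀ d r θ → d * (r * θ) ≡ θ * (d * r)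
        q₁ = solve-∀ ℚ-ring
        q₂ : ∀ θ n x → θ * (n * x) ≡ n * (θ * x)
        q₂ = solve-∀ ℚ-ring
        extract : ∀ ŝ → (∀ e → 0ℚ ≤ ŝ e) → (picks : List (Fin (N ℕ.+ m))) → length picks ≡ T →
          (∀ e → ŝ e ≡ 0ℚ ⊎ e ∈ picks) → ∀ {G H} →
          IsGram (λ e → (Z + Z * r) * ŵ e - ŝ e) G → IsGram (λ e → ŝ e - (Z * d - Z) * ŵ e) H →
          Sparsified w T (Z * (d - 2ℚ)) 1ℚ (Z * (d + (1ℚ + 2ℚ + 2ℚ)))
        extract ŝ ŝ≥0 picks #picks support upper lower = record
          { s       = s
          ; s≥0     = λ j → ŝ≥0 (N ↑ʳ j)
          ; picks   = rightParts N picks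
          ; #picks  = subst (length (rightParts N picks) ℕ.≤_) #picks (length-rightParts N picks)
          ; support = λ j → [ inj₁ , (λ j∈ → inj₂ (∈-rightParts N j∈)) ]′ (support (N ↑ʳ j))
          ; above   = λ x bits → [ (λ none → ℚ.≤-reflexive (flat x none (Z * (d - 2ℚ)) 1ℚ))
                                 , above x bits ]′ (cut-dichotomy w 0<w heavy x bits)
          ; below   = λ x bits → [ (λ none → ℚ.≤-reflexive (sym (flat x none (Z * (d + (1ℚ + 2ℚ + 2ℚ))) 1ℚ)))
                                 , below x bits ]′ (cut-dichotomy w 0<w heavy x bits)
          }
          where
          s : Fin m → ℚ
          s j = ŝ (N ↑ʳ j)
          virtual norm² : (Fin N → ℚ) → ℚ
          virtual x = ∑ (λ i → ŝ (i ↑ˡ m) * (x i * x i))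
          norm² x = ∑ (λ i → x i * x i)
          u l : ℚ
          u = Z + Z * r
          l = Z * d - Z
          0≤u : 0ℚ ≤ u
          0≤u = +-nonNeg (ℚ.<⇒≤ 0<Z) (*-nonNeg (ℚ.<⇒≤ 0<Z) (ℚ.<⇒≤ 0<r))
          0≤l : 0ℚ ≤ l
          0≤l = subst (0ℚ ≤_) (trans (q Z (toℚ d′)) (cong (λ x → Z * x - Z) (sym (toℚ-+ 1 d′))))
            (*-nonNeg (ℚ.<⇒≤ 0<Z) (toℚ-nonNeg d′))
            where
            q : ∀ z x → z * x ≡ z * (1ℚ + x) - z
            q = solve-∀ ℚ-ring

          form : (Fin (N ℕ.+ m) → ℚ) → (Fin N → ℚ) → ℚ
          form b x = ∑ (λ e → b e * (dot x e * dot x e))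
          form-split : ∀ b x →
            form b x ≡ ∑ (λ i → b (i ↑ˡ m) * (x i * x i)) + ∑ (λ j → b (N ↑ʳ j) * apart x j)
          form-split b x = trans (∑-split N (λ e → b e * (dot x e * dot x e))) (cong₂ _+_
            (sum-cong-≗ (λ i → cong (λ y → b (i ↑ˡ m) * (y * y)) (dot-vertex x i)))
            (sum-cong-≗ (λ j → cong (λ y → b (N ↑ʳ j) * (y * y)) (dot-edge x j))))
          form-ŵ : ∀ x → form ŵ x ≡ norm² x + cut w x
          form-ŵ x = trans (form-split ŵ x) (cong₂ _+_
            (sum-cong-≗ (λ i → trans (cong (_* (x i * x i)) (lookup-++ˡ (λ (_ : Fin N) → 1ℚ) w i))
              (ℚ.*-identityˡ (x i * x i))))
            (sum-cong-≗ (λ j → cong (_* apart x j) (lookup-++ʳ (λ (_ : Fin N) → 1ℚ) w j))))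
          upper-form : ∀ x → 0ℚ ≤ u * (norm² x + cut w x) - (virtual x + cut s x)
          upper-form x = subst (0ℚ ≤_)
            (trans (sum-cong-≗ (λ e → q u (ŵ e) (ŝ e) (dot x e * dot x e)))
              (trans (∑-linear (λ e → u * (ŵ e * (dot x e * dot x e))) (- 1ℚ) (λ e → ŝ e * (dot x e * dot x e)))
                (trans (cong (_+ - 1ℚ * form ŝ x) (sym (*-distribˡ-sum u (λ e → ŵ e * (dot x e * dot x e)))))
                  (trans (cong₂ (λ a b → u * a + - 1ℚ * b) (form-ŵ x) (form-split ŝ x))
                    (q′ (u * (norm² x + cut w x)) (virtual x + cut s x))))))
            (form-nonNeg upper (x , λ _ → refl))
            where
            q : ∀ u w s y → (u * w - s) * y ≡ u * (w * y) + - 1ℚ * (s * y)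
            q = solve-∀ ℚ-ring
            q′ : ∀ a b → a + - 1ℚ * b ≡ a - b
            q′ = solve-∀ ℚ-ring
          lower-form : ∀ x → 0ℚ ≤ virtual x + cut s x - l * (norm² x + cut w x)
          lower-form x = subst (0ℚ ≤_)
            (trans (sum-cong-≗ (λ e → q l (ŵ e) (ŝ e) (dot x e * dot x e)))
              (trans (∑-linear (λ e → ŝ e * (dot x e * dot x e)) (- l) (λ e → ŵ e * (dot x e * dot x e)))
                (trans (cong₂ (λ a b → b + - l * a) (form-ŵ x) (form-split ŝ x))
                  (q′ l (norm² x + cut w x) (virtual x + cut s x)))))
            (form-nonNeg lower (x , λ _ → refl))
            where
            q : ∀ l w s y → (s - l * w) * y ≡ s * y + - l * (w * y)
            q = solve-∀ ℚ-ring
            q′ : ∀ l a b → b + - l * a ≡ b - l * a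
            q′ = solve-∀ ℚ-ring

          flat : ∀ x → (∀ j → apart x j ≡ 0ℚ) → ∀ a b → a * cut w x ≡ b * cut s x
          flat x none a b = trans (cong (a *_) (zero-cut w)) (trans (ℚ.*-zeroʳ a)
            (sym (trans (cong (b *_) (zero-cut s)) (ℚ.*-zeroʳ b))))
            where
            zero-cut : ∀ v → cut v x ≡ 0ℚ
            zero-cut v = ∑-zero (λ j → trans (cong (v j *_) (none j)) (ℚ.*-zeroʳ (v j)))

          ones : Fin N → ℚ
          ones _ = 1ℚ

          -- The all-ones vector crosses no edge, so the upper barrier bounds the
          -- total weight given to the unit rows.
          virtual≤ : ∀ x → (∀ i → IsBit (x i)) → virtual x ≤ u * toℚ N
          virtual≤ x bits = ℚ.≤-trans
            (∑-mono (λ i → *-monoʳ (ŝ≥0 (i ↑ˡ m))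
              (subst (_≤ 1ℚ) (sym (bit-idem (bits i))) (bit≤1 (bits i)))))
            (≤-by (u * (norm² ones + cut w ones) - (virtual ones + cut s ones)) (upper-form ones)
              (trans (cong₂ (λ a b → virtual ones + (u * (norm² ones + a) - (virtual ones + b)))
                  (zero-cut w) (zero-cut s))
                (trans (q (virtual ones) u (norm² ones)) (cong (u *_) (trans (∑-const N 1ℚ) (ℚ.*-identityʳ (toℚ N)))))))
            where
            zero-cut : ∀ v → cut v ones ≡ 0ℚ
            zero-cut v = ∑-zero (λ j → ℚ.*-zeroʳ (v j))
            q : ∀ v u n → v + (u * (n + 0ℚ) - (v + 0ℚ)) ≡ u * n
            q = solve-∀ ℚ-ring

          norm²≤ : ∀ x → (∀ i → IsBit (x i)) → norm² x ≤ toℚ N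
          norm²≤ x bits = subst (norm² x ≤_) (trans (∑-const N 1ℚ) (ℚ.*-identityʳ (toℚ N)))
            (∑-mono (λ i → subst (_≤ 1ℚ) (sym (bit-idem (bits i))) (bit≤1 (bits i))))

          norm²-nonNeg : ∀ x → 0ℚ ≤ norm² x
          norm²-nonNeg x = ∑-nonNeg (λ i → sq-nonNeg (x i))

          virtual-nonNeg : ∀ x → 0ℚ ≤ virtual x
          virtual-nonNeg x = ∑-nonNeg (λ i → *-nonNeg (ŝ≥0 (i ↑ˡ m)) (sq-nonNeg (x i)))

          below : ∀ x → (∀ i → IsBit (x i)) → toℚ N * (d + (2ℚ + 2ℚ)) ≤ cut w x →
            1ℚ * cut s x ≤ Z * (d + (1ℚ + 2ℚ + 2ℚ)) * cut w x
          below x bits large = ≤-by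
            (u * (norm² x + cut w x) - (virtual x + cut s x)
              + (u * (toℚ N - norm² x) + (virtual x + Z * (cut w x - toℚ N * (d + (2ℚ + 2ℚ))))))
            (+-nonNeg (upper-form x) (+-nonNeg (*-nonNeg 0≤u (≤⇒0≤- (norm²≤ x bits)))
              (+-nonNeg (virtual-nonNeg x) (*-nonNeg (ℚ.<⇒≤ 0<Z) (≤⇒0≤- large)))))
            (q Z d (norm² x) (cut w x) (virtual x) (cut s x) (toℚ N))
            where
            q : ∀ Z d X M S A n → 1ℚ * A + ((Z + Z * (d + (1ℚ + 2ℚ))) * (X + M) - (S + A)
              + ((Z + Z * (d + (1ℚ + 2ℚ))) * (n - X) + (S + Z * (M - n * (d + (2ℚ + 2ℚ))))))
              ≡ Z * (d + (1ℚ + 2ℚ + 2ℚ)) * M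
            q = solve-∀ ℚ-ring

          above : ∀ x → (∀ i → IsBit (x i)) → toℚ N * (d + (2ℚ + 2ℚ)) ≤ cut w x →
            Z * (d - 2ℚ) * cut w x ≤ 1ℚ * cut s x
          above x bits large = ≤-by
            (virtual x + cut s x - l * (norm² x + cut w x)
              + (u * toℚ N - virtual x + (l * norm² x + Z * (cut w x - toℚ N * (d + (2ℚ + 2ℚ))))))
            (+-nonNeg (lower-form x) (+-nonNeg (≤⇒0≤- (virtual≤ x bits))
              (+-nonNeg (*-nonNeg 0≤l (norm²-nonNeg x)) (*-nonNeg (ℚ.<⇒≤ 0<Z) (≤⇒0≤- large)))))
            (q Z d (norm² x) (cut w x) (virtual x) (cut s x) (toℚ N))
            where
            q : ∀ Z d X M S A n → Z * (d - 2ℚ) * M + (S + A - (Z * d - Z) * (X + M)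
              + ((Z + Z * (d + (1ℚ + 2ℚ))) * n - S + ((Z * d - Z) * X + Z * (M - n * (d + (2ℚ + 2ℚ))))))
              ≡ 1ℚ * A
            q = solve-∀ ℚ-ring

    cut-scale : ∀ a w x → cut (λ j → a * w j) x ≡ a * cut w x
    cut-scale a w x = trans (sum-cong-≗ (λ j → ℚ.*-assoc a (w j) (apart x j)))
      (sym (*-distribˡ-sum a (λ j → w j * apart x j)))

    make-heavy : ∀ Λ → 0ℚ ≤ Λ → (w : Fin m → ℚ) → (∀ j → 0ℚ < w j) →
      ∃ λ a → 0ℚ < a × ∀ j → Λ ≤ a * w j
    make-heavy Λ 0≤Λ w 0<w = 1ℚ + ∑ i , +-pos-nonNeg 0<1 (∑-nonNeg 0≤i) , λ j →
      ≤-by ((1ℚ + (∑ i - i j)) * w j)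
        (*-nonNeg (+-nonNeg (ℚ.<⇒≤ 0<1) (≤⇒0≤- (term≤∑ 0≤i j))) (ℚ.<⇒≤ (0<w j)))
        (trans (cong (_+ (1ℚ + (∑ i - i j)) * w j) (sym (i*w j))) (q (i j) (w j) (∑ i)))
      where
      i : Fin m → ℚ
      i j = Λ * proj₁ (recip (0<w j))
      0≤i : ∀ j → 0ℚ ≤ i j
      0≤i j = *-nonNeg 0≤Λ (ℚ.<⇒≤ (proj₁ (proj₂ (recip (0<w j)))))
      i*w : ∀ j → i j * w j ≡ Λ
      i*w j = trans (ℚ.*-assoc Λ _ (w j)) (trans (cong (Λ *_) (proj₂ (proj₂ (recip (0<w j)))))
        (ℚ.*-identityʳ Λ))
      q : ∀ i w s → i * w + (1ℚ + (s - i)) * w ≡ (1ℚ + s) * w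
      q = solve-∀ ℚ-ring

    cut-sparsifier : 0ℚ < toℚ N → ∀ d′ (w : Fin m → ℚ) → (∀ j → 0ℚ < w j) → let d = toℚ (suc d′) in
      Sparsified w (N ℕ.* (suc d′ ℕ.* (suc d′ ℕ.+ 3))) (d - 2ℚ) (d + 1ℚ) (d + (1ℚ + 2ℚ + 2ℚ))
    cut-sparsifier 0<N d′ w 0<w =
      let a , 0<a , heavy = make-heavy (toℚ N * (d + (2ℚ + 2ℚ)))
            (*-nonNeg (ℚ.<⇒≤ 0<N) (ℚ.<⇒≤ (ℚ.+-mono-< 0<d (ℚ.positive⁻¹ (2ℚ + 2ℚ))))) w 0<w
          0<aw = λ j → *-pos 0<a (0<w j)
          Z = toℚ N * (d * (d + (1ℚ + 2ℚ)))
          0<Z = Heavy.0<Z 0<N d′ (λ j → a * w j) 0<aw heavy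
          sp = Heavy.sparsified 0<N d′ (λ j → a * w j) 0<aw heavy
          i , 0<i , i-eq = recip (*-pos (*-pos 0<a 0<Z) 0<d+1)
      in rescale Z a i (ℚ.<⇒≤ 0<i) i-eq sp
      where
      d : ℚ
      d = toℚ (suc d′)
      0<d : 0ℚ < d
      0<d = toℚ-pos d′
      0<d+1 : 0ℚ < d + 1ℚ
      0<d+1 = ℚ.+-mono-< 0<d 0<1
      rescale : ∀ {T lo hi} Z a i → 0ℚ ≤ i → i * (a * Z * (d + 1ℚ)) ≡ 1ℚ →
        Sparsified (λ j → a * w j) T (Z * lo) 1ℚ (Z * hi) → Sparsified w T lo (d + 1ℚ) hi
      rescale {T} {lo} {hi} Z a i 0≤i i-eq sp = record
        { s       = λ j → i * s j
        ; s≥0     = λ j → *-nonNeg 0≤i (s≥0 j)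
        ; picks   = picks
        ; #picks  = #picks
        ; support = λ j → [ (λ s≡0 → inj₁ (trans (cong (i *_) s≡0) (ℚ.*-zeroʳ i))) , inj₂ ]′ (support j)
        ; above   = λ x bits → subst₂ _≤_
            (trans (cong (λ y → (d + 1ℚ) * i * (Z * lo * y)) (cut-scale a w x)) (normal lo x)) (mid≡ x)
            (*-monoʳ 0≤η (above x bits))
        ; below   = λ x bits → subst₂ _≤_ (mid≡ x)
            (trans (cong (λ y → (d + 1ℚ) * i * (Z * hi * y)) (cut-scale a w x)) (normal hi x))
            (*-monoʳ 0≤η (below x bits))
        }
        where
        open Sparsified sp
        0≤η : 0ℚ ≤ (d + 1ℚ) * i
        0≤η = *-nonNeg (ℚ.<⇒≤ 0<d+1) 0≤i
        normal : ∀ c x → (d + 1ℚ) * i * (Z * c * (a * cut w x)) ≡ c * cut w x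
        normal c x = trans (q (d + 1ℚ) i Z c a (cut w x))
          (trans (cong (_* (c * cut w x)) i-eq) (ℚ.*-identityˡ (c * cut w x)))
          where
          q : ∀ e i z c a m → e * i * (z * c * (a * m)) ≡ i * (a * z * e) * (c * m)
          q = solve-∀ ℚ-ring
        mid≡ : ∀ x → (d + 1ℚ) * i * (1ℚ * cut s x) ≡ (d + 1ℚ) * cut (λ j → i * s j) x
        mid≡ x = trans (q (d + 1ℚ) i (cut s x)) (cong ((d + 1ℚ) *_) (sym (cut-scale i s x)))
          where
          q : ∀ e i c → e * i * (1ℚ * c) ≡ e * (i * c)
          q = solve-∀ ℚ-ring

    bichromatic : ∀ {K} → (Fin m → ℚ) → (Fin N → Fin K) → ℚ
    bichromatic w F = ∑ (λ j → w j * (1ℚ - δ (F (src j)) (F (tgt j))))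

    ∑-cuts : ∀ {K} w (F : Fin N → Fin K) → ∑ (λ t → cut w (λ i → δ (F i) t)) ≡ 2ℚ * bichromatic w F
    ∑-cuts {K} w F = trans (∑-comm (λ t j → w j * apart (λ i → δ (F i) t) j))
      (trans (sum-cong-≗ (λ j → trans
          (sym (*-distribˡ-sum (w j) (λ t → apart (λ i → δ (F i) t) j)))
          (trans (cong (w j *_) (apart-sum (F (src j)) (F (tgt j)))) (q (w j) (δ (F (src j)) (F (tgt j)))))))
        (sym (*-distribˡ-sum 2ℚ (λ j → w j * (1ℚ - δ (F (src j)) (F (tgt j)))))))
      where
      q : ∀ w x → w * (2ℚ - 2ℚ * x) ≡ 2ℚ * (w * (1ℚ - x))
      q = solve-∀ ℚ-ring
      apart-sum : ∀ (a b : Fin K) → ∑ (λ t → (δ a t - δ b t) * (δ a t - δ b t)) ≡ 2ℚ - 2ℚ * δ a b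
      apart-sum a b = trans
        (sum-cong-≗ (λ t → q₁ (δ a t) (δ b t)))
        (trans (∑-linear₃ (λ t → δ a t * δ a t) (- 1ℚ) (λ t → δ a t * δ b t)
                  (- 1ℚ) (λ t → δ b t * δ a t) 1ℚ (λ t → δ b t * δ b t))
          (trans (cong₂ _+_ (cong₂ _+_ (cong₂ (λ x y → x + - 1ℚ * y)
                    (trans (∑-δ a (δ a)) (δ-refl a))
                    (trans (∑-δ a (δ b)) (δ-sym b a)))
                    (cong (- 1ℚ *_) (∑-δ b (δ a))))
                    (cong (1ℚ *_) (trans (∑-δ b (δ b)) (δ-refl b))))
            (q₂ (δ a b))))
        where
        q₁ : ∀ x y → (x - y) * (x - y) ≡ x * x + - 1ℚ * (x * y) + - 1ℚ * (y * x) + 1ℚ * (y * y)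
        q₁ = solve-∀ ℚ-ring
        q₂ : ∀ x → 1ℚ + - 1ℚ * x + - 1ℚ * x + 1ℚ * 1ℚ ≡ 2ℚ - 2ℚ * x
        q₂ = solve-∀ ℚ-ring

    sum-over-colours : ∀ {K} a b v w (F : Fin N → Fin K) →
      (∀ x → (∀ i → IsBit (x i)) → a * cut v x ≤ b * cut w x) →
      a * bichromatic v F ≤ b * bichromatic w F
    sum-over-colours {K} a b v w F h = ℚ.*-cancelˡ-≤-pos 2ℚ (subst₂ _≤_ (total a v) (total b w)
      (∑-mono (λ t → h (λ i → δ (F i) t) (λ i → δ-bit (F i) t))))
      where
      total : ∀ a v → ∑ (λ t → a * cut v (λ i → δ (F i) t)) ≡ 2ℚ * (a * bichromatic v F)
      total a v = trans (sym (*-distribˡ-sum a (λ t → cut v (λ i → δ (F i) t))))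
        (trans (cong (a *_) (∑-cuts v F)) (q a (bichromatic v F)))
        where
        q : ∀ a x → a * (2ℚ * x) ≡ 2ℚ * (a * x)
        q = solve-∀ ℚ-ring

module ColouredPredicate where

  open import Data.Rational.Base hiding (∣_∣)
  open import Data.Fin.Subset using (_∈_; _⊆_; ∣_∣)
  open RationalSums

  ∣pair∣≡2 : ∀ {k} {a b : Fin k} → a ≢ b → ∣ ⁅ a ⁆ ∪ ⁅ b ⁆ ∣ ≡ 2
  ∣pair∣≡2 {a = zero}  {zero}  a≢b = contradiction refl a≢b
  ∣pair∣≡2 {a = zero}  {suc b} a≢b =
    cong suc (trans (cong ∣_∣ (∪-identityˡ ⁅ b ⁆)) (∣⁅x⁆∣≡1 b))
  ∣pair∣≡2 {a = suc a} {zero}  a≢b =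
    cong suc (trans (cong ∣_∣ (∪-identityʳ ⁅ a ⁆)) (∣⁅x⁆∣≡1 a))
  ∣pair∣≡2 {a = suc a} {suc b} a≢b = ∣pair∣≡2 (a≢b ∘ cong suc)

  Elem-≡ : ∀ {k} {D : Subset k} {x y : Elem D} → proj₁ x ≡ proj₁ y → x ≡ y
  Elem-≡ {x = x , p} {.x , q} refl = cong (x ,_) ([]=-irrelevant p q)

  first : ∀ {k} → (Fin k → Bool) → Fin (suc k)
  first {zero}  p = zero
  first {suc k} p = if p zero then zero else suc (first (p ∘ suc))

  first-common : ∀ {k} (p q : Fin k → Bool) → first p ≡ first q → ∀ i → p i ≡ true →
    ∃ λ j → p j ≡ true × q j ≡ true
  first-common {suc k} p q eq i pi with p zero in p₀ | q zero in q₀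
  first-common {suc k} p q eq i       pi | true  | true  = zero , p₀ , q₀
  first-common {suc k} p q eq zero    pi | false | false = contradiction (trans (sym p₀) pi) λ ()
  first-common {suc k} p q eq (suc i) pi | false | false
    with j , pj , qj ← first-common (p ∘ suc) (q ∘ suc) (Fin.suc-injective eq) i pi = suc j , pj , qj

  first-cong : ∀ {k} {p q : Fin k → Bool} → (∀ i → p i ≡ q i) → first p ≡ first q
  first-cong {zero}  h = refl
  first-cong {suc k} {p} {q} h rewrite h zero | first-cong (h ∘ suc) = refl

  module _ {k} {D E : Subset k} (P : Predicate D E) where

    singleton-restriction : ∀ {a b c d} (a∈ : a ∈ D) (b∈ : b ∈ D) (c∈ : c ∈ E) (d∈ : d ∈ E) →
      P (a , a∈) (c , c∈) ≡ true → P (a , a∈) (d , d∈) ≡ false →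
      P (b , b∈) (c , c∈) ≡ false → P (b , b∈) (d , d∈) ≡ false → HasSingletonRestriction P
    singleton-restriction {a} {b} {c} {d} a∈ b∈ c∈ d∈ Pac Pad Pbc Pbd =
      ⁅ a ⁆ ∪ ⁅ b ⁆ , ⁅ c ⁆ ∪ ⁅ d ⁆ , pair⊆ a∈ b∈ , pair⊆ c∈ d∈ ,
      ∣pair∣≡2 {a = a} {b} (λ { refl → true≢false (value a∈ c∈ Pac) (value a∈ c∈ Pbc) }) ,
      ∣pair∣≡2 {a = c} {d} (λ { refl → true≢false (value a∈ c∈ Pac) (value a∈ c∈ Pad) }) ,
      ((a , p⊆p∪q ⁅ b ⁆ (x∈⁅x⁆ a)) , (c , p⊆p∪q ⁅ d ⁆ (x∈⁅x⁆ c))) ,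
      value _ _ Pac ,
      only
      where
      pair⊆ : ∀ {x y} {S : Subset k} → x ∈ S → y ∈ S → ⁅ x ⁆ ∪ ⁅ y ⁆ ⊆ S
      pair⊆ {x} {y} x∈ y∈ z∈ with x∈p∪q⁻ ⁅ x ⁆ ⁅ y ⁆ z∈
      ... | inj₁ z∈x rewrite x∈⁅y⁆⇒x≡y x z∈x = x∈
      ... | inj₂ z∈y rewrite x∈⁅y⁆⇒x≡y y z∈y = y∈
      value : ∀ {x y v} {x∈ : x ∈ D} {y∈ : y ∈ E} (x∈′ : x ∈ D) (y∈′ : y ∈ E) →
        P (x , x∈) (y , y∈) ≡ v → P (x , x∈′) (y , y∈′) ≡ v
      value x∈′ y∈′ h = trans (cong₂ P (Elem-≡ refl) (Elem-≡ refl)) h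
      true≢false : ∀ {v} → v ≡ true → v ≡ false → ⊥
      true≢false refl ()
      only : ∀ {t} → restrict (pair⊆ a∈ b∈) (pair⊆ c∈ d∈) P (proj₁ t) (proj₂ t) ≡ true →
        ((a , p⊆p∪q ⁅ b ⁆ (x∈⁅x⁆ a)) , (c , p⊆p∪q ⁅ d ⁆ (x∈⁅x⁆ c))) ≡ t
      only {(x , x∈) , (y , y∈)} Pxy with x∈p∪q⁻ ⁅ a ⁆ ⁅ b ⁆ x∈ | x∈p∪q⁻ ⁅ c ⁆ ⁅ d ⁆ y∈
      ... | inj₁ x∈a | inj₁ y∈c =
        cong₂ _,_ (Elem-≡ (sym (x∈⁅y⁆⇒x≡y a x∈a))) (Elem-≡ (sym (x∈⁅y⁆⇒x≡y c y∈c)))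
      ... | inj₁ x∈a | inj₂ y∈d with refl ← x∈⁅y⁆⇒x≡y a x∈a | refl ← x∈⁅y⁆⇒x≡y d y∈d =
        contradiction (value _ _ Pad) (true≢false Pxy)
      ... | inj₂ x∈b | inj₁ y∈c with refl ← x∈⁅y⁆⇒x≡y b x∈b | refl ← x∈⁅y⁆⇒x≡y c y∈c =
        contradiction (value _ _ Pbc) (true≢false Pxy)
      ... | inj₂ x∈b | inj₂ y∈d with refl ← x∈⁅y⁆⇒x≡y b x∈b | refl ← x∈⁅y⁆⇒x≡y d y∈d =
        contradiction (value _ _ Pbd) (true≢false Pxy)

    -- Without a singleton restriction the zero sets of any two rows are equal or
    -- disjoint, so P says that two colours differ.
    module Colouring (no-singleton : ¬ HasSingletonRestriction P) where

      zeros : Fin k → Fin k → Bool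
      zeros a c with a ∈? D | c ∈? E
      ... | yes a∈ | yes c∈ = not (P (a , a∈) (c , c∈))
      ... | yes _  | no _   = false
      ... | no _   | _      = false

      zeros-view : ∀ {a c} → zeros a c ≡ true →
        ∃ λ a∈ → ∃ λ c∈ → P (a , a∈) (c , c∈) ≡ false
      zeros-view {a} {c} h with a ∈? D | c ∈? E
      ... | yes a∈ | yes c∈ = a∈ , c∈ , Bool.not-injective h

      zeros-≡ : ∀ x y → zeros (proj₁ x) (proj₁ y) ≡ not (P x y)
      zeros-≡ (a , a∈) (c , c∈) with a ∈? D | c ∈? E
      ... | yes a∈′ | yes c∈′ = cong not (cong₂ P (Elem-≡ refl) (Elem-≡ refl))
      ... | yes _   | no c∉   = contradiction c∈ c∉
      ... | no a∉   | _       = contradiction a∈ a∉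

      zeros-⊆ : ∀ {a b y} → zeros a y ≡ true → zeros b y ≡ true → ∀ {z} → zeros a z ≡ true → zeros b z ≡ true
      zeros-⊆ {a} {b} {y} ay by {z} az
        with a∈ , y∈ , Pay ← zeros-view ay | b∈ , y∈′ , Pby ← zeros-view {b} by | a∈′ , z∈ , Paz ← zeros-view {a} az
        with P (b , b∈) (z , z∈) in Pbz
      ... | false = trans (zeros-≡ (b , b∈) (z , z∈)) (cong not Pbz)
      ... | true  = contradiction
        (singleton-restriction b∈ a∈ z∈ y∈ Pbz
          (trans (cong (P (b , b∈)) (Elem-≡ refl)) Pby)
          (trans (cong (λ x → P x (z , z∈)) (Elem-≡ refl)) Paz) Pay)
        no-singleton

      zeros-≗ : ∀ {a b y} → zeros a y ≡ true → zeros b y ≡ true → ∀ z → zeros a z ≡ zeros b z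
      zeros-≗ {a} {b} ay by z with zeros a z in az | zeros b z in bz
      ... | true  | true  = refl
      ... | false | false = refl
      ... | true  | false = trans (sym (zeros-⊆ {a} {b} ay by {z} az)) bz
      ... | false | true  = trans (sym az) (zeros-⊆ {b} {a} by ay {z} bz)

      rowColour : Fin k → Fin (suc (suc k))
      rowColour a = suc (first (zeros a))

      columnColour : Fin k → Fin (suc (suc k))
      columnColour c with Fin.any? (λ a → zeros a c Bool.≟ true)
      ... | yes (a , _) = rowColour a
      ... | no _        = zero

      zero⇒same : ∀ a c → zeros a c ≡ true → rowColour a ≡ columnColour c
      zero⇒same a c ac with Fin.any? (λ a → zeros a c Bool.≟ true)
      ... | yes (b , bc) = cong suc (first-cong (zeros-≗ {a} {b} ac bc))
      ... | no none      = contradiction (a , ac) none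

      same⇒zero : ∀ a c → rowColour a ≡ columnColour c → zeros a c ≡ true
      same⇒zero a c eq with Fin.any? (λ a → zeros a c Bool.≟ true)
      ... | yes (b , bc)
        with j , bj , aj ← first-common (zeros b) (zeros a) (sym (Fin.suc-injective eq)) c bc =
        trans (zeros-≗ {a} {b} aj bj c) bc

      P-colours : ∀ x y →
        (if P x y then 1ℚ else 0ℚ) ≡ 1ℚ - δ (rowColour (proj₁ x)) (columnColour (proj₁ y))
      P-colours x y with P x y in Pxy
      ... | false rewrite sym (zero⇒same (proj₁ x) (proj₁ y) (trans (zeros-≡ x y) (cong not Pxy)))
                        | δ-refl (rowColour (proj₁ x)) = refl
      ... | true  rewrite δ-≢ {i = rowColour (proj₁ x)} {columnColour (proj₁ y)} (λ eq →
        contradiction (trans (sym (same⇒zero (proj₁ x) (proj₁ y) eq)) (trans (zeros-≡ x y) (cong not Pxy))) λ ()) = refl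

module RealApproximation where

  open import Data.Rational.Base
  open import Data.List.Membership.Propositional using (_∈_)
  open RationalSums

  ∣∣<⇒< : ∀ {x y} → ∣ x ∣ < y → x < y
  ∣∣<⇒< {x} h with ℚ.≤-total 0ℚ x
  ... | inj₁ 0≤x = subst (_< _) (ℚ.0≤p⇒∣p∣≡p 0≤x) h
  ... | inj₂ x≤0 = ℚ.≤-<-trans (ℚ.≤-trans x≤0 (ℚ.0≤∣p∣ x)) h

  settle : ∀ (x : ℝ) {τ} → 0ℚ < τ → ∀ N₀ →
    ∃ λ N → N₀ ℕ.≤ N × ∀ n → N ℕ.≤ n → seq x N - τ ≤ seq x n × seq x n ≤ seq x N + τ
  settle x {τ} 0<τ N₀ with N , h ← cauchy x τ 0<τ =
    N₀ ℕ.⊔ N , ℕ.m≤m⊔n N₀ N , λ n N≤n →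
      ( ≤-by _ (ℚ.<⇒≤ (<⇒0<- (∣∣<⇒< (h (N₀ ℕ.⊔ N) n (ℕ.m≤n⊔m N₀ N) (ℕ.m⊔n≤o⇒n≤o N₀ N N≤n)))))
          (q₁ (seq x (N₀ ℕ.⊔ N)) τ (seq x n))
      , ≤-by _ (ℚ.<⇒≤ (<⇒0<- (∣∣<⇒< (h n (N₀ ℕ.⊔ N) (ℕ.m⊔n≤o⇒n≤o N₀ N N≤n) (ℕ.m≤n⊔m N₀ N)))))
          (q₂ (seq x (N₀ ℕ.⊔ N)) τ (seq x n)))
    where
    q₁ : ∀ a t y → a - t + (t - (a - y)) ≡ y
    q₁ = solve-∀ ℚ-ring
    q₂ : ∀ a t y → y + (t - (y - a)) ≡ a + t
    q₂ = solve-∀ ℚ-ring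

  eventually-positive : ∀ (x : ℝ) → 0ᴿ <ᴿ x →
    ∃ λ η → 0ℚ < η × ∃ λ N → ∀ n → N ℕ.≤ n → η ≤ seq x n
  eventually-positive x (η , 0<η , N , h) =
    η , 0<η , N , λ n N≤n → subst (_≤ seq x n) (ℚ.+-identityˡ η) (h n N≤n)

  approximate : ∀ (x : ℝ) → 0ᴿ <ᴿ x → ∀ {d} → 0ℚ < d →
    ∃ λ a → 0ℚ < a × ∃ λ N → ∀ n → N ℕ.≤ n → a ≤ seq x n × d * seq x n ≤ (d + 1ℚ) * a
  approximate x 0<x {d} 0<d =
    let η , 0<η , N₀ , η≤x = eventually-positive x 0<x
        i , 0<i , i-eq = recip 0<2d+1
        0<τ = *-pos 0<η 0<i
        N , N₀≤N , close = settle x 0<τ N₀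
    in seq x N - η * i
     , ℚ.<-≤-trans (*-pos (*-pos (*-pos (ℚ.positive⁻¹ 2ℚ) 0<d) 0<η) 0<i) (positive′ i-eq (η≤x N N₀≤N))
     , N , λ n N≤n → proj₁ (close n N≤n) ,
         ℚ.≤-trans (*-monoʳ (ℚ.<⇒≤ 0<d) (proj₂ (close n N≤n))) (upper i-eq (η≤x N N₀≤N))
    where
    0<2d+1 : 0ℚ < 2ℚ * d + 1ℚ
    0<2d+1 = ℚ.+-mono-< (*-pos (ℚ.positive⁻¹ 2ℚ) 0<d) 0<1
    positive′ : ∀ {η i a} → i * (2ℚ * d + 1ℚ) ≡ 1ℚ → η ≤ a → 2ℚ * d * η * i ≤ a - η * i
    positive′ {η} {i} {a} i-eq η≤a = ≤-by (a - η) (≤⇒0≤- η≤a)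
      (trans (q d η i a) (trans (cong (λ y → a - η * i - η * (1ℚ - y)) i-eq) (q′ a (η * i) η)))
      where
      q : ∀ d η i a → 2ℚ * d * η * i + (a - η) ≡ a - η * i - η * (1ℚ - i * (2ℚ * d + 1ℚ))
      q = solve-∀ ℚ-ring
      q′ : ∀ a x η → a - x - η * (1ℚ - 1ℚ) ≡ a - x
      q′ = solve-∀ ℚ-ring
    upper : ∀ {η i a} → i * (2ℚ * d + 1ℚ) ≡ 1ℚ → η ≤ a → d * (a + η * i) ≤ (d + 1ℚ) * (a - η * i)
    upper {η} {i} {a} i-eq η≤a = ≤-by (a - η) (≤⇒0≤- η≤a)
      (trans (q d η i a) (trans (cong (λ y → (d + 1ℚ) * (a - η * i) - η * (1ℚ - y)) i-eq)
        (q′ ((d + 1ℚ) * (a - η * i)) η)))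
      where
      q : ∀ d η i a → d * (a + η * i) + (a - η)
        ≡ (d + 1ℚ) * (a - η * i) - η * (1ℚ - i * (2ℚ * d + 1ℚ))
      q = solve-∀ ℚ-ring
      q′ : ∀ x η → x - η * (1ℚ - 1ℚ) ≡ x
      q′ = solve-∀ ℚ-ring

  archimedean : ∀ x → ∃ λ n → x ≤ toℚ n
  archimedean (mkℚ (ℤ.+ n) s _) = n , ℚ.toℚᵘ-cancel-≤
    (ℚᵘ.≤-respʳ-≃ (ℚᵘ.≃-sym (ℚ.toℚᵘ-fromℚᵘ (ℚᵘ.mkℚᵘ (ℤ.+ n) 0)))
      (ℚᵘ.*≤* (subst₂ ℤ._≤_ (ℤ.pos-* n 1) (ℤ.pos-* n (suc s))
        (ℤ.+≤+ (ℕ.*-monoʳ-≤ n (ℕ.s≤s ℕ.z≤n))))))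
  archimedean x@(mkℚ ℤ.-[1+ _ ] _ _) = 0 , ℚ.<⇒≤ (ℚ.negative⁻¹ x)

  small-multiple : ∀ {a} → a ≤ 1ℚ → ∀ n → 2ℚ ≤ toℚ n * a →
    ∃ λ q → 2ℚ ≤ toℚ (suc q) * a × toℚ (suc q) * a ≤ 1ℚ + 2ℚ
  small-multiple {a} a≤1 zero h =
    contradiction (subst (2ℚ ≤_) (ℚ.*-zeroˡ a) h) (<⇒≱ (ℚ.positive⁻¹ 2ℚ))
  small-multiple {a} a≤1 (suc n) h with 2ℚ ℚ.≤? toℚ n * a
  ... | yes h′ = small-multiple a≤1 n h′
  ... | no  h′ = n , h , subst (_≤ 1ℚ + 2ℚ) (sym (trans (cong (_* a) (toℚ-+ 1 n)) (q (toℚ n) a)))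
    (ℚ.+-mono-≤ a≤1 (ℚ.<⇒≤ (ℚ.≰⇒> h′)))
    where
    q : ∀ n a → (1ℚ + n) * a ≡ a + n * a
    q = solve-∀ ℚ-ring

  5ℚ : ℚ
  5ℚ = 1ℚ + 2ℚ + 2ℚ

  integral-reciprocal : ∀ ε → 0ᴿ <ᴿ ε → ε <ᴿ 1ᴿ → ∃ λ q → ∃ λ N → ∀ n → N ℕ.≤ n →
    0ℚ ≤ seq ε n × 1ℚ ≤ toℚ (suc q) * seq ε n × toℚ (suc q) * seq ε n ≤ 5ℚ
  integral-reciprocal ε 0<ε (η₁ , 0<η₁ , N₁ , ε<1) =
    let η , 0<η , N₀ , η≤ε = eventually-positive ε 0<ε
        N , N≥ , close = settle ε (*-pos (ℚ.positive⁻¹ ½) 0<η) (N₀ ℕ.⊔ N₁)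
        a = seq ε N
        η≤a = η≤ε N (ℕ.m⊔n≤o⇒m≤o N₀ N₁ N≥)
        a≤1 = ℚ.≤-trans (≤-by η₁ (ℚ.<⇒≤ 0<η₁) refl) (ε<1 N (ℕ.m⊔n≤o⇒n≤o N₀ N₁ N≥))
        0<a = ℚ.<-≤-trans 0<η η≤a
        i , 0<i , i-eq = recip 0<a
        n , 2i≤n = archimedean (2ℚ * i)
        q , lo , hi = small-multiple a≤1 n (subst (_≤ toℚ n * a)
          (trans (ℚ.*-assoc 2ℚ i a) (cong (2ℚ *_) i-eq)) (ℚ.*-monoʳ-≤-nonNeg a {{nonNegative (ℚ.<⇒≤ 0<a)}} 2i≤n))
    in q , N , λ n N≤n →
         let a-½η≤ , ≤a+½η = close n N≤n in
         bounds (toℚ (suc q)) a η (seq ε n) (toℚ-nonNeg (suc q)) 0<a η≤a a-½η≤ ≤a+½η lo hi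
    where
    bounds : ∀ Q a η e → 0ℚ ≤ Q → 0ℚ < a → η ≤ a → a - ½ * η ≤ e → e ≤ a + ½ * η →
      2ℚ ≤ Q * a → Q * a ≤ 1ℚ + 2ℚ → 0ℚ ≤ e × 1ℚ ≤ Q * e × Q * e ≤ 5ℚ
    bounds Q a η e 0≤Q 0<a η≤a lower upper lo hi =
        ℚ.≤-trans (*-nonNeg 0≤½ (ℚ.<⇒≤ 0<a)) half≤e
      , ℚ.≤-trans (≤-by (½ * (Q * a - 2ℚ)) (*-nonNeg 0≤½ (≤⇒0≤- lo)) (q₁ Q a)) (*-monoʳ 0≤Q half≤e)
      , ≤-by (Q * (a + ½ * η - e) + (Q * (½ * (a - η)) + (1ℚ + ½) * (1ℚ + 2ℚ - Q * a) + ½))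
          (+-nonNeg (*-nonNeg 0≤Q (≤⇒0≤- upper))
            (+-nonNeg (+-nonNeg (*-nonNeg 0≤Q (*-nonNeg 0≤½ (≤⇒0≤- η≤a)))
              (*-nonNeg (+-nonNeg (ℚ.<⇒≤ 0<1) 0≤½) (≤⇒0≤- hi))) 0≤½))
          (q₂ Q a η e)
      where
      0≤½ : 0ℚ ≤ ½
      0≤½ = ℚ.<⇒≤ (ℚ.positive⁻¹ ½)
      half≤e : ½ * a ≤ e
      half≤e = ℚ.≤-trans (≤-by (½ * (a - η)) (*-nonNeg 0≤½ (≤⇒0≤- η≤a)) (q a η)) lower
        where
        q : ∀ a η → ½ * a + ½ * (a - η) ≡ a - ½ * η
        q = solve-∀ ℚ-ring
      q₁ : ∀ Q a → 1ℚ + ½ * (Q * a - 2ℚ) ≡ Q * (½ * a)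
      q₁ = solve-∀ ℚ-ring
      q₂ : ∀ Q a η e → Q * e + (Q * (a + ½ * η - e)
        + (Q * (½ * (a - η)) + (1ℚ + ½) * (1ℚ + 2ℚ - Q * a) + ½)) ≡ 5ℚ
      q₂ = solve-∀ ℚ-ring

  uniformly : ∀ {m} {Q : Fin m → ℕ → Set} → (∀ j → ∃ λ N → ∀ n → N ℕ.≤ n → Q j n) →
    ∃ λ N → ∀ n → N ℕ.≤ n → ∀ j → Q j n
  uniformly {zero}  h = 0 , λ n _ ()
  uniformly {suc m} h with N , hN ← h zero | M , hM ← uniformly (h ∘ suc) =
    N ℕ.⊔ M , λ { n ≤n zero    → hN n (ℕ.m⊔n≤o⇒m≤o N M ≤n)
                ; n ≤n (suc j) → hM n (ℕ.m⊔n≤o⇒n≤o N M ≤n) j }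

  module _ {A : Set} where

    lookup-unique : ∀ {xs : List A} → Unique xs → ∀ i j → lookup xs i ≡ lookup xs j → i ≡ j
    lookup-unique (x∉ ∷ u) zero    zero    eq = refl
    lookup-unique (x∉ ∷ u) zero    (suc j) eq = contradiction eq (All.lookup x∉ (∈-lookup j))
    lookup-unique (x∉ ∷ u) (suc i) zero    eq = contradiction (sym eq) (All.lookup x∉ (∈-lookup i))
    lookup-unique (x∉ ∷ u) (suc i) (suc j) eq = cong suc (lookup-unique u i j eq)

    length-unique-⊆ : ∀ {xs ys : List A} → Unique xs → (∀ {x} → x ∈ xs → x ∈ ys) →
      length xs ℕ.≤ length ys
    length-unique-⊆ {xs} {ys} u xs⊆ys = injective⇒≤ {f = λ i → index (xs⊆ys (∈-lookup {xs = xs} i))}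
      (λ {i} {j} eq → lookup-unique u i j
        (trans (lookup-index (xs⊆ys (∈-lookup {xs = xs} i)))
          (trans (cong (lookup ys) eq) (sym (lookup-index (xs⊆ys (∈-lookup {xs = xs} j)))))))

    seq-sumᴿ : ∀ (xs : List A) (f : ∀ {x} → x ∈ xs → ℝ) n →
      seq (sumᴿ (mapWith∈ xs f)) n ≡ ∑ (λ i → seq (f (∈-lookup {xs = xs} i)) n)
    seq-sumᴿ []       f n = refl
    seq-sumᴿ (x ∷ xs) f n = cong (seq (f (here refl)) n +_) (seq-sumᴿ xs (f ∘ there) n)

    ∑-filter : ∀ {Q : A → Set} (Q? : ∀ x → Dec (Q x)) (φ : A → ℚ) → (∀ x → ¬ Q x → φ x ≡ 0ℚ) →
      ∀ xs → ∑ (λ i → φ (lookup (filter Q? xs) i)) ≡ ∑ (λ i → φ (lookup xs i))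
    ∑-filter Q? φ h []       = refl
    ∑-filter Q? φ h (x ∷ xs) with Q? x
    ... | yes _ = cong (φ x +_) (∑-filter Q? φ h xs)
    ... | no ¬q = trans (∑-filter Q? φ h xs)
      (trans (sym (ℚ.+-identityˡ _)) (cong (_+ ∑ (λ i → φ (lookup xs i))) (sym (h x ¬q))))

module LinearSparsifier where

  open import Data.Rational.Base
  open RationalSums
  open CutSparsifier
  open ColouredPredicate
  open RealApproximation
  open import Data.List.Membership.Propositional using (_∈_)


  module Sparsifier {k} {D E : Subset k} (P : Predicate D E)
    (no-singleton : ¬ HasSingletonRestriction P) {n : ℕ} (I : Instance n) where

    open Colouring P no-singleton

    m : ℕ
    m = length (Π I)

    constraint : Fin m → Constraint n
    constraint = lookup (Π I)

    -- The two positions of a constraint use different colourings of the labels,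
    -- so every variable is split into two vertices.
    src tgt : Fin m → Fin (n ℕ.+ n)
    src j = proj₁ (constraint j) ↑ˡ n
    tgt j = n ↑ʳ proj₂ (constraint j)

    open Laplacian src tgt

    module _ (A : Assignment P {n}) where

      satisfied : Constraint n → ℚ
      satisfied (u , v) = 1ℚ - δ (rowColour (proj₁ (A u))) (columnColour (proj₁ (A v)))

      satisfied-nonNeg : ∀ c → 0ℚ ≤ satisfied c
      satisfied-nonNeg (u , v)
        with δ-bit (rowColour (proj₁ (A u))) (columnColour (proj₁ (A v)))
      ... | inj₁ δ≡0 = subst (λ x → 0ℚ ≤ 1ℚ - x) (sym δ≡0) (ℚ.<⇒≤ 0<1)
      ... | inj₂ δ≡1 = subst (λ x → 0ℚ ≤ 1ℚ - x) (sym δ≡1) ℚ.≤-refl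

      vertexColour : Fin (n ℕ.+ n) → Fin (suc (suc k))
      vertexColour = (λ u → rowColour (proj₁ (A u))) ++ (λ v → columnColour (proj₁ (A v)))

      bichromatic-satisfied : ∀ w →
        bichromatic w vertexColour ≡ ∑ (λ j → w j * satisfied (constraint j))
      bichromatic-satisfied w = sum-cong-≗ (λ j → cong₂ (λ a b → w j * (1ℚ - δ a b))
        (lookup-++ˡ (λ u → rowColour (proj₁ (A u))) (λ v → columnColour (proj₁ (A v))) (proj₁ (constraint j)))
        (lookup-++ʳ (λ u → rowColour (proj₁ (A u))) (λ v → columnColour (proj₁ (A v))) (proj₂ (constraint j))))

      Val-satisfied : ∀ (J : Instance n) (valid : Valid P J A) t → seq (Val P J A valid) t
        ≡ ∑ (λ j → seq (weight J (∈-lookup {xs = Π J} j)) t * satisfied (lookup (Π J) j))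
      Val-satisfied J valid t = trans (seq-sumᴿ (Π J) _ t)
        (sum-cong-≗ (λ j → cong (seq (weight J (∈-lookup {xs = Π J} j)) t *_)
          (trans (seq-if _ t) (P-colours _ _))))
        where
        seq-if : ∀ b t → seq (if b then 1ᴿ else 0ᴿ) t ≡ (if b then 1ℚ else 0ℚ)
        seq-if true  t = refl
        seq-if false t = refl

    module Extend (s : Fin m → ℚ) where

      extended : Constraint n → ℚ
      extended c with any? (×.≡-dec Fin._≟_ Fin._≟_ c) (Π I)
      ... | yes c∈ = s (index c∈)
      ... | no _   = 0ℚ

      extended-constraint : ∀ j → extended (constraint j) ≡ s j
      extended-constraint j with any? (×.≡-dec Fin._≟_ Fin._≟_ (constraint j)) (Π I)
      ... | yes c∈ = cong s (sym (lookup-unique (unique I) j (index c∈) (lookup-index c∈)))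
      ... | no c∉  = contradiction (∈-lookup j) c∉

      sparse : Instance n
      sparse = record
        { Π        = filter (λ c → 0ℚ ℚ.<? extended c) (Π I)
        ; unique   = filter⁺ (λ c → 0ℚ ℚ.<? extended c) (unique I)
        ; distinct = λ c∈ → distinct I (proj₁ (kept c∈))
        ; weight   = λ {c} _ → fromℚ (extended c)
        ; weight>0 = λ {c} c∈ → extended c , proj₂ (kept c∈) , 0 ,
            λ _ _ → ℚ.≤-reflexive (ℚ.+-identityˡ (extended c))
        }
        where
        kept : ∀ {c} → c ∈ filter (λ c → 0ℚ ℚ.<? extended c) (Π I) → c ∈ Π I × 0ℚ < extended c
        kept = ∈-filter⁻ (λ c → 0ℚ ℚ.<? extended c) {xs = Π I}

      sparse⊆ : ∀ {c} → c ∈ Π sparse → c ∈ Π I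
      sparse⊆ c∈ = proj₁ (∈-filter⁻ (λ c → 0ℚ ℚ.<? extended c) {xs = Π I} c∈)

      Val-sparse : (∀ j → 0ℚ ≤ s j) → ∀ A (valid : Valid P sparse A) t →
        seq (Val P sparse A valid) t ≡ bichromatic s (vertexColour A)
      Val-sparse s≥0 A valid t = trans (Val-satisfied A sparse valid t) (trans
        (∑-filter (λ c → 0ℚ ℚ.<? extended c) (λ c → extended c * satisfied A c) vanish (Π I))
        (trans (sum-cong-≗ (λ j → cong (_* satisfied A (constraint j)) (extended-constraint j)))
          (sym (bichromatic-satisfied A s))))
        where
        extended-nonNeg : ∀ c → 0ℚ ≤ extended c
        extended-nonNeg c with any? (×.≡-dec Fin._≟_ Fin._≟_ c) (Π I)
        ... | yes c∈ = s≥0 (index c∈)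
        ... | no _   = ℚ.≤-refl
        vanish : ∀ c → ¬ 0ℚ < extended c → extended c * satisfied A c ≡ 0ℚ
        vanish c 0≮ = trans
          (cong (_* satisfied A c) (ℚ.≤-antisym (ℚ.≮⇒≥ 0≮) (extended-nonNeg c)))
          (ℚ.*-zeroˡ (satisfied A c))

      #sparse≤ : (picks : List (Fin m)) → (∀ j → s j ≡ 0ℚ ⊎ j ∈ picks) →
        #constraints sparse ℕ.≤ length picks
      #sparse≤ picks support = subst (#constraints sparse ℕ.≤_) (length-map constraint picks)
        (length-unique-⊆ (unique sparse) picked)
        where
        picked : ∀ {c} → c ∈ Π sparse → c ∈ map constraint picks
        picked {c} c∈ with ∈-filter⁻ (λ c → 0ℚ ℚ.<? extended c) {xs = Π I} c∈
        ... | c∈Π , 0<s with support (index c∈Π)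
        ...   | inj₂ j∈  = subst (_∈ map constraint picks) (sym (lookup-index c∈Π)) (∈-map⁺ constraint j∈)
        ...   | inj₁ s≡0 = contradiction 0<s (ℚ.<-irrefl (sym (trans
          (trans (cong extended (lookup-index c∈Π)) (extended-constraint (index c∈Π))) s≡0)))

    module Approximate (0<n : 0ℚ < toℚ (n ℕ.+ n)) (ε : ℝ) (q : ℕ) (Nε : ℕ)
      (ε≈1/q : ∀ t → Nε ℕ.≤ t → 0ℚ ≤ seq ε t × 1ℚ ≤ toℚ (suc q) * seq ε t × toℚ (suc q) * seq ε t ≤ 5ℚ)
      where

      d′ : ℕ
      d′ = q ℕ.+ 3 ℕ.* suc q

      d Q : ℚ
      d = toℚ (suc d′)
      Q = toℚ (suc q)

      d≡4Q : d ≡ (2ℚ + 2ℚ) * Q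
      d≡4Q = toℚ-* 4 (suc q)

      ω : Fin m → ℝ
      ω j = weight I (∈-lookup {xs = Π I} j)

      approx : ∀ j → ∃ λ a → 0ℚ < a × ∃ λ N → ∀ t → N ℕ.≤ t → a ≤ seq (ω j) t × d * seq (ω j) t ≤ (d + 1ℚ) * a
      approx j = approximate (ω j) (weight>0 I (∈-lookup {xs = Π I} j)) (toℚ-pos d′)

      w̃ : Fin m → ℚ
      w̃ j = proj₁ (approx j)

      close : ∃ λ N → ∀ t → N ℕ.≤ t → ∀ j → w̃ j ≤ seq (ω j) t × d * seq (ω j) t ≤ (d + 1ℚ) * w̃ j
      close = uniformly {Q = λ j t → w̃ j ≤ seq (ω j) t × d * seq (ω j) t ≤ (d + 1ℚ) * w̃ j}
        (λ j → proj₂ (proj₂ (approx j)))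

      open Sparsified (cut-sparsifier 0<n d′ w̃ (λ j → proj₁ (proj₂ (approx j)))) public
      open Extend s public

      1≤Q : 1ℚ ≤ Q
      1≤Q = subst (1ℚ ≤_) (sym (toℚ-+ 1 q)) (≤-by (toℚ q) (toℚ-nonNeg q) refl)

      module _ (A : Assignment P {n}) (valid : Valid P I A) (t : ℕ)
        (t≥ : proj₁ close ℕ.⊔ Nε ℕ.≤ t) where

        private
          M M̃ Ã e : ℚ
          M = seq (Val P I A valid) t
          M̃ = bichromatic w̃ (vertexColour A)
          Ã = bichromatic s (vertexColour A)
          e = seq ε t
          near : ∀ j → w̃ j ≤ seq (ω j) t × d * seq (ω j) t ≤ (d + 1ℚ) * w̃ j
          near = proj₂ close t (ℕ.m⊔n≤o⇒m≤o (proj₁ close) Nε t≥)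
          φ : Fin m → ℚ
          φ j = satisfied A (constraint j)
          0≤φ : ∀ j → 0ℚ ≤ φ j
          0≤φ j = satisfied-nonNeg A (constraint j)
          M̃≤M : M̃ ≤ M
          M̃≤M = subst₂ _≤_ (sym (bichromatic-satisfied A w̃)) (sym (Val-satisfied A I valid t))
            (∑-mono (λ j → ℚ.*-monoʳ-≤-nonNeg (φ j) {{nonNegative (0≤φ j)}} (proj₁ (near j))))
          dM≤ : d * M ≤ (d + 1ℚ) * M̃
          dM≤ = subst₂ _≤_
            (trans (sym (*-distribˡ-sum d (λ j → seq (ω j) t * φ j))) (cong (d *_) (sym (Val-satisfied A I valid t))))
            (trans (sym (*-distribˡ-sum (d + 1ℚ) (λ j → w̃ j * φ j)))
              (cong ((d + 1ℚ) *_) (sym (bichromatic-satisfied A w̃))))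
            (∑-mono (λ j → subst₂ _≤_ (ℚ.*-assoc d (seq (ω j) t) (φ j)) (ℚ.*-assoc (d + 1ℚ) (w̃ j) (φ j))
              (ℚ.*-monoʳ-≤-nonNeg (φ j) {{nonNegative (0≤φ j)}} (proj₂ (near j)))))
          0≤M : 0ℚ ≤ M
          0≤M = ℚ.≤-trans (subst (0ℚ ≤_) (sym (bichromatic-satisfied A w̃))
            (∑-nonNeg (λ j → *-nonNeg (ℚ.<⇒≤ (proj₁ (proj₂ (approx j)))) (0≤φ j)))) M̃≤M
          ε-bounds : 0ℚ ≤ e × 1ℚ ≤ Q * e × Q * e ≤ 5ℚ
          ε-bounds = ε≈1/q t (ℕ.m⊔n≤o⇒n≤o (proj₁ close) Nε t≥)
          0≤e : 0ℚ ≤ e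
          0≤e = proj₁ ε-bounds
          0≤de-4 : 0ℚ ≤ d * e - (2ℚ + 2ℚ)
          0≤de-4 = subst (0ℚ ≤_) (trans (q₁ Q e) (cong (λ x → x * e - (2ℚ + 2ℚ)) (sym d≡4Q)))
            (*-nonNeg (ℚ.<⇒≤ (ℚ.positive⁻¹ (2ℚ + 2ℚ))) (≤⇒0≤- (proj₁ (proj₂ ε-bounds))))
            where
            q₁ : ∀ Q e → (2ℚ + 2ℚ) * (Q * e - 1ℚ) ≡ (2ℚ + 2ℚ) * Q * e - (2ℚ + 2ℚ)
            q₁ = solve-∀ ℚ-ring
          0≤d-2 : 0ℚ ≤ d - 2ℚ
          0≤d-2 = subst (0ℚ ≤_) (trans (q₁ Q) (cong (_- 2ℚ) (sym d≡4Q)))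
            (+-nonNeg (*-nonNeg (ℚ.<⇒≤ (ℚ.positive⁻¹ (2ℚ + 2ℚ))) (≤⇒0≤- 1≤Q)) (ℚ.<⇒≤ (ℚ.positive⁻¹ 2ℚ)))
            where
            q₁ : ∀ Q → (2ℚ + 2ℚ) * (Q - 1ℚ) + 2ℚ ≡ (2ℚ + 2ℚ) * Q - 2ℚ
            q₁ = solve-∀ ℚ-ring
          0≤d+2 : 0ℚ ≤ d + 2ℚ
          0≤d+2 = +-nonNeg (toℚ-nonNeg (suc d′)) (ℚ.<⇒≤ (ℚ.positive⁻¹ 2ℚ))
          0<d+1 : 0ℚ < d + 1ℚ
          0<d+1 = ℚ.+-mono-< (toℚ-pos d′) 0<1
          0≤d+5 : 0ℚ ≤ d + (1ℚ + 2ℚ + 2ℚ)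
          0≤d+5 = +-nonNeg (toℚ-nonNeg (suc d′)) (ℚ.<⇒≤ (ℚ.positive⁻¹ 5ℚ))
          above′ : (d - 2ℚ) * M̃ ≤ (d + 1ℚ) * Ã
          above′ = sum-over-colours (d - 2ℚ) (d + 1ℚ) w̃ s (vertexColour A) above
          below′ : (d + 1ℚ) * Ã ≤ (d + (1ℚ + 2ℚ + 2ℚ)) * M̃
          below′ = sum-over-colours (d + 1ℚ) (d + (1ℚ + 2ℚ + 2ℚ)) s w̃ (vertexColour A) below

        Val-above : (1ℚ - e) * M ≤ Ã
        Val-above = ≤-by (Ã - (1ℚ - e) * M)
          (*-cancelˡ-nonNeg (*-pos 0<d+1 0<d+1) (subst (0ℚ ≤_) (q₁ d Ã M̃ M e)
            (+-nonNeg (+-nonNeg (*-nonNeg (ℚ.<⇒≤ 0<d+1) (≤⇒0≤- above′)) (*-nonNeg 0≤d-2 (≤⇒0≤- dM≤)))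
              (*-nonNeg 0≤M (+-nonNeg (+-nonNeg (*-nonNeg 0≤de-4 0≤d+2) 0≤e)
                (ℚ.<⇒≤ (ℚ.positive⁻¹ (5ℚ + 2ℚ))))))))
          (q₂ Ã ((1ℚ - e) * M))
          where
          q₁ : ∀ d a n m e →
            (d + 1ℚ) * ((d + 1ℚ) * a - (d - 2ℚ) * n) + (d - 2ℚ) * ((d + 1ℚ) * n - d * m)
              + m * ((d * e - (2ℚ + 2ℚ)) * (d + 2ℚ) + e + (5ℚ + 2ℚ))
            ≡ (d + 1ℚ) * (d + 1ℚ) * (a - (1ℚ - e) * m)
          q₁ = solve-∀ ℚ-ring
          q₂ : ∀ a b → b + (a - b) ≡ a
          q₂ = solve-∀ ℚ-ring

        Val-below : Ã ≤ (1ℚ + e) * M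
        Val-below = ≤-by ((1ℚ + e) * M - Ã)
          (*-cancelˡ-nonNeg 0<d+1 (subst (0ℚ ≤_) (q₁ d Ã M̃ M e)
            (+-nonNeg (+-nonNeg (≤⇒0≤- below′) (*-nonNeg 0≤d+5 (≤⇒0≤- M̃≤M)))
              (*-nonNeg 0≤M (+-nonNeg 0≤de-4 0≤e)))))
          (q₂ ((1ℚ + e) * M) Ã)
          where
          q₁ : ∀ d a n m e →
            (d + (1ℚ + 2ℚ + 2ℚ)) * n - (d + 1ℚ) * a + (d + (1ℚ + 2ℚ + 2ℚ)) * (m - n)
              + m * (d * e - (2ℚ + 2ℚ) + e)
            ≡ (d + 1ℚ) * ((1ℚ + e) * m - a)
          q₁ = solve-∀ ℚ-ring
          q₂ : ∀ a b → b + (a - b) ≡ a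
          q₂ = solve-∀ ℚ-ring

      is-sparsifier : IsSparsifier P ε I sparse
      is-sparsifier = sparse⊆ , λ A valid →
          (λ δ′ 0<δ′ → proj₁ close ℕ.⊔ Nε , λ t t≥ → ℚ.≤-trans (Val-above A valid t t≥)
            (≤-by δ′ (ℚ.<⇒≤ 0<δ′)
              (cong (_+ δ′) (sym (Val-sparse s≥0 A (valid ∘ sparse⊆) t)))))
        , (λ δ′ 0<δ′ → proj₁ close ℕ.⊔ Nε , λ t t≥ →
            subst (_≤ (1ℚ + seq ε t) * seq (Val P I A valid) t + δ′)
              (sym (Val-sparse s≥0 A (valid ∘ sparse⊆) t))
              (ℚ.≤-trans (Val-below A valid t t≥) (≤-by δ′ (ℚ.<⇒≤ 0<δ′) refl)))

      -- There are at most 2n d (d + 3) constraints with d = 4Q, and Q ε ≤ 5.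
      size : ∀ t → Nε ℕ.≤ t → toℚ (#constraints sparse) * (seq ε t * seq ε t) ≤ toℚ 1400 * toℚ n
      size t t≥ = ℚ.≤-trans
        (ℚ.*-monoʳ-≤-nonNeg (e * e) {{nonNegative (sq-nonNeg e)}}
          (toℚ-mono (ℕ.≤-trans (#sparse≤ picks support) #picks)))
        (≤-by gap
          (+-nonNeg
            (*-nonNeg (*-nonNeg (toℚ-nonNeg n) (ℚ.<⇒≤ (ℚ.positive⁻¹ ((2ℚ + 2ℚ) * (5ℚ + 5ℚ + 2ℚ + 2ℚ)))))
              (*-nonNeg (≤⇒0≤- Qe≤5) (+-nonNeg (ℚ.<⇒≤ (ℚ.positive⁻¹ 5ℚ)) (*-nonNeg 0≤Q 0≤e))))
            (*-nonNeg (*-nonNeg (*-nonNeg (toℚ-nonNeg n) (ℚ.<⇒≤ (ℚ.positive⁻¹ ((2ℚ + 2ℚ) * (5ℚ + 1ℚ))))) (sq-nonNeg e))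
              (*-nonNeg 0≤Q (≤⇒0≤- 1≤Q))))
          (trans (cong (λ x → x * (e * e) + gap) T≡) (q₁ (toℚ n) Q e)))
        where
        e : ℚ
        e = seq ε t
        gap : ℚ
        gap = toℚ n * ((2ℚ + 2ℚ) * (5ℚ + 5ℚ + 2ℚ + 2ℚ)) * ((5ℚ - Q * e) * (5ℚ + Q * e))
            + toℚ n * ((2ℚ + 2ℚ) * (5ℚ + 1ℚ)) * (e * e) * (Q * (Q - 1ℚ))
        0≤e : 0ℚ ≤ e
        0≤e = proj₁ (ε≈1/q t t≥)
        Qe≤5 : Q * e ≤ 5ℚ
        Qe≤5 = proj₂ (proj₂ (ε≈1/q t t≥))
        0≤Q : 0ℚ ≤ Q
        0≤Q = toℚ-nonNeg (suc q)
        T≡ : toℚ ((n ℕ.+ n) ℕ.* (suc d′ ℕ.* (suc d′ ℕ.+ 3)))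
          ≡ (toℚ n + toℚ n) * ((2ℚ + 2ℚ) * Q * ((2ℚ + 2ℚ) * Q + (1ℚ + 2ℚ)))
        T≡ = trans (toℚ-* (n ℕ.+ n) _) (cong₂ _*_ (toℚ-+ n n)
          (trans (toℚ-* (suc d′) (suc d′ ℕ.+ 3))
            (cong₂ _*_ d≡4Q (trans (toℚ-+ (suc d′) 3) (cong (_+ (1ℚ + 2ℚ)) d≡4Q)))))
        q₁ : ∀ n Q e → (n + n) * ((2ℚ + 2ℚ) * Q * ((2ℚ + 2ℚ) * Q + (1ℚ + 2ℚ))) * (e * e)
          + (n * ((2ℚ + 2ℚ) * (5ℚ + 5ℚ + 2ℚ + 2ℚ)) * ((5ℚ - Q * e) * (5ℚ + Q * e))
            + n * ((2ℚ + 2ℚ) * (5ℚ + 1ℚ)) * (e * e) * (Q * (Q - 1ℚ)))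
          ≡ toℚ 1400 * n
        q₁ = solve-∀ ℚ-ring

  linear-sparsifier : ∀ {k} {D E : Subset k} (P : Predicate D E) → ¬ HasSingletonRestriction P →
    ∀ ε → 0ᴿ <ᴿ ε → ε <ᴿ 1ᴿ → ∀ n (I : Instance n) → Σ (Instance n) λ Iε →
      IsSparsifier P ε I Iε × fromℕ (#constraints Iε) *ᴿ (ε *ᴿ ε) ≤ᴿ fromℕ 1400 *ᴿ fromℕ n
  linear-sparsifier P no-singleton ε 0<ε ε<1 zero I@record { Π = [] } = I , ((λ c∈ → c∈) , λ A valid →
      (λ δ′ 0<δ′ → 0 , λ t _ → ≤-by δ′ (ℚ.<⇒≤ 0<δ′) (cong (_+ δ′) (ℚ.*-zeroʳ (1ℚ - seq ε t))))
    , (λ δ′ 0<δ′ → 0 , λ t _ → ≤-by δ′ (ℚ.<⇒≤ 0<δ′) (cong (_+ δ′) (sym (ℚ.*-zeroʳ (1ℚ + seq ε t))))))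
    , λ δ′ 0<δ′ → 0 , λ t _ → ≤-by δ′ (ℚ.<⇒≤ 0<δ′)
        (cong (_+ δ′) (trans (ℚ.*-zeroˡ (seq ε t * seq ε t)) (sym (ℚ.*-zeroʳ (toℚ 1400)))))
  linear-sparsifier P no-singleton ε 0<ε ε<1 zero record { Π = (() , _) ∷ _ }
  linear-sparsifier P no-singleton ε 0<ε ε<1 (suc n) I =
    let q , N , ε≈1/q = integral-reciprocal ε 0<ε ε<1
        module S = Sparsifier P no-singleton I
        module A = S.Approximate (toℚ-pos (n ℕ.+ suc n)) ε q N ε≈1/q
    in A.sparse , A.is-sparsifier , λ δ′ 0<δ′ → N , λ t t≥ →
         ℚ.≤-trans (A.size t t≥) (≤-by δ′ (ℚ.<⇒≤ 0<δ′) refl)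

module QuadraticLowerBound where

  open import Data.Rational.Base hiding (∣_∣)
  open RationalSums
  open ColouredPredicate
  open RealApproximation
  open import Data.List.Membership.Propositional using (_∈_; _∉_)

  another-element : ∀ {k} (B : Subset k) → Subset.∣ B ∣ ≡ 2 → ∀ x → ∃ λ y → y Subset.∈ B × y ≢ x
  another-element B ∣B∣≡2 x with Fin.any? (λ y → y ∈? B ×-dec ¬? (y ≟ x))
  ... | yes found = found
  ... | no none = contradiction
    (subst₂ ℕ._≤_ ∣B∣≡2 (∣⁅x⁆∣≡1 x) (p⊆q⇒∣p∣≤∣q∣ B⊆x))
    λ { (ℕ.s≤s ()) }
    where
    B⊆x : B Subset.⊆ ⁅ x ⁆
    B⊆x {y} y∈B with y ≟ x
    ... | yes refl = x∈⁅x⁆ x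
    ... | no y≢x   = contradiction (y , y∈B , y≢x) none

  length-cartesianProduct : ∀ {A B : Set} (xs : List A) (ys : List B) →
    length (cartesianProduct xs ys) ≡ length xs ℕ.* length ys
  length-cartesianProduct []       ys = refl
  length-cartesianProduct (x ∷ xs) ys = trans (length-++ (map (x ,_) ys))
    (cong₂ ℕ._+_ (length-map (x ,_) ys) (length-cartesianProduct xs ys))

  module CompleteBipartite (N : ℕ) where

    left right : List (Fin (N ℕ.+ N))
    left  = map (_↑ˡ N) (allFin N)
    right = map (N ↑ʳ_) (allFin N)

    complete : Instance (N ℕ.+ N)
    complete = record
      { Π        = cartesianProduct left right
      ; unique   = cartesianProduct⁺ (map⁺ (λ {i} {j} → ↑ˡ-injective N i j) (allFin⁺ N))
                     (map⁺ (λ {i} {j} → ↑ʳ-injective N i j) (allFin⁺ N))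
      ; distinct = λ c∈ → sides-differ (∈-cartesianProduct⁻ left right c∈)
      ; weight   = λ _ → 1ᴿ
      ; weight>0 = λ _ → 1ℚ , 0<1 , 0 , λ _ _ → ℚ.≤-refl
      }
      where
      sides-differ : ∀ {u v} → u ∈ left × v ∈ right → u ≢ v
      sides-differ (u∈ , v∈) refl with ∈-map⁻ (_↑ˡ N) u∈ | ∈-map⁻ (N ↑ʳ_) v∈
      ... | i , _ , u≡ | j , _ , v≡ = contradiction
        (trans (sym (splitAt-↑ˡ N i N)) (trans (cong (splitAt N) (trans (sym u≡) v≡)) (splitAt-↑ʳ N N j)))
        λ ()

    edge∈ : ∀ i j → (i ↑ˡ N , N ↑ʳ j) ∈ Π complete
    edge∈ i j = ∈-cartesianProduct⁺ (∈-map⁺ (_↑ˡ N) (∈-allFin i)) (∈-map⁺ (N ↑ʳ_) (∈-allFin j))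

    edge∈⁻ : ∀ {c} → c ∈ Π complete → ∃ λ i → ∃ λ j → c ≡ (i ↑ˡ N , N ↑ʳ j)
    edge∈⁻ {u , v} c∈ with ∈-cartesianProduct⁻ left right c∈
    ... | u∈ , v∈ with ∈-map⁻ (_↑ˡ N) u∈ | ∈-map⁻ (N ↑ʳ_) v∈
    ... | i , _ , u≡ | j , _ , v≡ = i , j , cong₂ _,_ u≡ v≡

    #complete : #constraints complete ≡ N ℕ.* N
    #complete = trans (length-cartesianProduct left right) (cong₂ ℕ._*_
      (trans (length-map (_↑ˡ N) (allFin N)) (length-tabulate {n = N} (λ i → i)))
      (trans (length-map (N ↑ʳ_) (allFin N)) (length-tabulate {n = N} (λ i → i))))

    module _ {k} {D E : Subset k} (P : Predicate D E)
      {b b′ c c′ : Fin k} (b∈ : b Subset.∈ D) (b′∈ : b′ Subset.∈ D) (c∈ : c Subset.∈ E) (c′∈ : c′ Subset.∈ E)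
      (P-bc : P (b , b∈) (c , c∈) ≡ true) (b′≢b : b′ ≢ b) (c′≢c : c′ ≢ c)
      (only : ∀ x y → proj₁ x ≡ b ⊎ proj₁ x ≡ b′ → proj₁ y ≡ c ⊎ proj₁ y ≡ c′ →
        P x y ≡ true → proj₁ x ≡ b × proj₁ y ≡ c) where

      isolate : Fin N → Fin N → Assignment P {N ℕ.+ N}
      isolate i j = (λ u → row u (u ≟ i)) ++ (λ v → column v (v ≟ j))
        where
        row : ∀ u → Dec (u ≡ i) → Elem (D ∪ E)
        row u (yes _) = b , p⊆p∪q E b∈
        row u (no _)  = b′ , p⊆p∪q E b′∈
        column : ∀ v → Dec (v ≡ j) → Elem (D ∪ E)
        column v (yes _) = c , q⊆p∪q D E c∈
        column v (no _)  = c′ , q⊆p∪q D E c′∈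

      module _ (i j : Fin N) where

        private
          A : Assignment P
          A = isolate i j

        row-value : ∀ u → (u ≡ i × proj₁ (A (u ↑ˡ N)) ≡ b) ⊎ (u ≢ i × proj₁ (A (u ↑ˡ N)) ≡ b′)
        row-value u rewrite splitAt-↑ˡ N u N with u ≟ i
        ... | yes u≡i = inj₁ (u≡i , refl)
        ... | no u≢i  = inj₂ (u≢i , refl)

        column-value : ∀ v → (v ≡ j × proj₁ (A (N ↑ʳ v)) ≡ c) ⊎ (v ≢ j × proj₁ (A (N ↑ʳ v)) ≡ c′)
        column-value v rewrite splitAt-↑ʳ N N v with v ≟ j
        ... | yes v≡j = inj₁ (v≡j , refl)
        ... | no v≢j  = inj₂ (v≢j , refl)

        isolate-valid : Valid P complete A
        isolate-valid uv∈ with edge∈⁻ uv∈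
        ... | u , v , refl = row∈ (row-value u) , column∈ (column-value v)
          where
          row∈ : (u ≡ i × proj₁ (A (u ↑ˡ N)) ≡ b) ⊎ (u ≢ i × proj₁ (A (u ↑ˡ N)) ≡ b′) →
            proj₁ (A (u ↑ˡ N)) Subset.∈ D
          row∈ (inj₁ (_ , eq)) = subst (Subset._∈ D) (sym eq) b∈
          row∈ (inj₂ (_ , eq)) = subst (Subset._∈ D) (sym eq) b′∈
          column∈ : (v ≡ j × proj₁ (A (N ↑ʳ v)) ≡ c) ⊎ (v ≢ j × proj₁ (A (N ↑ʳ v)) ≡ c′) →
            proj₁ (A (N ↑ʳ v)) Subset.∈ E
          column∈ (inj₁ (_ , eq)) = subst (Subset._∈ E) (sym eq) c∈
          column∈ (inj₂ (_ , eq)) = subst (Subset._∈ E) (sym eq) c′∈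

        isolated-true : ∀ {e} → e ≡ (i ↑ˡ N , N ↑ʳ j) →
          ∀ p q → P (proj₁ (A (proj₁ e)) , p) (proj₁ (A (proj₂ e)) , q) ≡ true
        isolated-true refl p q with row-value i | column-value j
        ... | inj₂ (i≢i , _)  | _               = contradiction refl i≢i
        ... | inj₁ _          | inj₂ (j≢j , _)  = contradiction refl j≢j
        ... | inj₁ (_ , A≡b)  | inj₁ (_ , A≡c)  =
          trans (cong₂ P (Elem-≡ A≡b) (Elem-≡ A≡c)) P-bc

        true-isolated : ∀ {e} → e ∈ Π complete →
          ∀ p q → P (proj₁ (A (proj₁ e)) , p) (proj₁ (A (proj₂ e)) , q) ≡ true → e ≡ (i ↑ˡ N , N ↑ʳ j)
        true-isolated e∈ p q Pe with edge∈⁻ e∈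
        ... | u , v , refl
          with row-value u | column-value v
        ... | inj₁ (u≡i , _) | inj₁ (v≡j , _) = cong₂ (λ u v → u ↑ˡ N , N ↑ʳ v) u≡i v≡j
        ... | inj₂ (_ , A≡b′) | inj₁ (_ , A≡c)  =
          contradiction (trans (sym A≡b′) (proj₁ (only _ _ (inj₂ A≡b′) (inj₁ A≡c) Pe))) b′≢b
        ... | inj₁ (_ , A≡b)  | inj₂ (_ , A≡c′) =
          contradiction (trans (sym A≡c′) (proj₂ (only _ _ (inj₁ A≡b) (inj₂ A≡c′) Pe))) c′≢c
        ... | inj₂ (_ , A≡b′) | inj₂ (_ , A≡c′) =
          contradiction (trans (sym A≡b′) (proj₁ (only _ _ (inj₂ A≡b′) (inj₂ A≡c′) Pe))) b′≢b

        Val-complete≥1 : ∀ t → 1ℚ ≤ seq (Val P complete A isolate-valid) t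
        Val-complete≥1 t = subst (1ℚ ≤_) (sym (seq-sumᴿ (Π complete) _ t))
          (ℚ.≤-trans (ℚ.≤-reflexive (sym (term≡1 _ (isolated-true (sym (lookup-index (edge∈ i j))) _ _))))
            (term≤∑ {f = λ l → seq (1ᴿ *ᴿ (if value l then 1ᴿ else 0ᴿ)) t}
              (λ l → term≥0 (value l)) (index (edge∈ i j))))
          where
          value : Fin (length (Π complete)) → Bool
          value l =
            let p , q = isolate-valid (∈-lookup {xs = Π complete} l)
            in P (_ , p) (_ , q)
          term≡1 : ∀ v → v ≡ true → seq (1ᴿ *ᴿ (if v then 1ᴿ else 0ᴿ)) t ≡ 1ℚ
          term≡1 _ refl = refl
          term≥0 : ∀ v → 0ℚ ≤ seq (1ᴿ *ᴿ (if v then 1ᴿ else 0ᴿ)) t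
          term≥0 true  = ℚ.<⇒≤ 0<1
          term≥0 false = ℚ.≤-refl

        Val-missing≡0 : ∀ J (J⊆ : ∀ {e} → e ∈ Π J → e ∈ Π complete) → (i ↑ˡ N , N ↑ʳ j) ∉ Π J →
          ∀ t → seq (Val P J A (isolate-valid ∘ J⊆)) t ≡ 0ℚ
        Val-missing≡0 J J⊆ e∉ t = trans (seq-sumᴿ (Π J) _ t) (∑-zero (λ l →
          term≡0 (weight J (∈-lookup {xs = Π J} l)) _ λ Pe → e∉ (subst (_∈ Π J)
            (true-isolated (J⊆ (∈-lookup {xs = Π J} l)) _ _ Pe) (∈-lookup {xs = Π J} l))))
          where
          term≡0 : ∀ w v → v ≢ true → seq (w *ᴿ (if v then 1ᴿ else 0ᴿ)) t ≡ 0ℚ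
          term≡0 w false _ = ℚ.*-zeroʳ (seq w t)
          term≡0 w true  v≢ = contradiction refl v≢

      sparsifier-keeps : ∀ ε → ε <ᴿ 1ᴿ → ∀ J → IsSparsifier P ε complete J →
        ∀ {e} → e ∈ Π complete → e ∈ Π J
      sparsifier-keeps ε (η , 0<η , N₁ , ε<1) J (J⊆ , bounds) e∈ with edge∈⁻ e∈
      ... | i , j , refl = decidable-stable (any? (×.≡-dec _≟_ _≟_ (i ↑ˡ N , N ↑ʳ j)) (Π J)) λ e∉ →
        let 0<½η = *-pos (ℚ.positive⁻¹ ½) 0<η
            N₂ , below = proj₁ (bounds (isolate i j) (isolate-valid i j)) (½ * η) 0<½η
            t = N₁ ℕ.⊔ N₂
            V = seq (Val P complete (isolate i j) (isolate-valid i j)) t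
            e = seq ε t
        in <⇒≱ (half<η 0<½η) (ℚ.≤-trans
             (η≤ e V (ε<1 t (ℕ.m≤m⊔n N₁ N₂)) (Val-complete≥1 i j t))
             (subst (λ x → (1ℚ - e) * V ≤ x + ½ * η) (Val-missing≡0 i j J J⊆ e∉ t)
               (below t (ℕ.m≤n⊔m N₁ N₂))))
        where
        half<η : 0ℚ < ½ * η → 0ℚ + ½ * η < η
        half<η 0<½η = <-by (½ * η) 0<½η (q η)
          where
          q : ∀ η → 0ℚ + ½ * η + ½ * η ≡ η
          q = solve-∀ ℚ-ring
        η≤ : ∀ e V → e + η ≤ 1ℚ → 1ℚ ≤ V → η ≤ (1ℚ - e) * V
        η≤ e V small 1≤V = ≤-by ((1ℚ - (e + η)) * V + η * (V - 1ℚ))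
          (+-nonNeg (*-nonNeg (≤⇒0≤- small) (ℚ.≤-trans (ℚ.<⇒≤ 0<1) 1≤V))
            (*-nonNeg (ℚ.<⇒≤ 0<η) (≤⇒0≤- 1≤V)))
          (q e η V)
          where
          q : ∀ e η V → η + ((1ℚ - (e + η)) * V + η * (V - 1ℚ)) ≡ (1ℚ - e) * V
          q = solve-∀ ℚ-ring

  quadratic-lower-bound : ∀ {k} {D E : Subset k} (P : Predicate D E) → HasSingletonRestriction P →
    ∀ ε → ε <ᴿ 1ᴿ → ∀ N (Iε : Instance (N ℕ.+ N)) →
    IsSparsifier P ε (CompleteBipartite.complete N) Iε → N ℕ.* N ℕ.≤ #constraints Iε
  quadratic-lower-bound {D = D} {E} P
    (B , C , B⊆D , C⊆E , ∣B∣≡2 , ∣C∣≡2 , ((b , b∈B) , (c , c∈C)) , P-bc , unique-bc) ε ε<1 N Iε sparse =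
    let b′ , b′∈B , b′≢b = another-element B ∣B∣≡2 b
        c′ , c′∈C , c′≢c = another-element C ∣C∣≡2 c
    in subst (ℕ._≤ #constraints Iε) #complete (length-unique-⊆ (unique complete)
         (sparsifier-keeps P (B⊆D b∈B) (B⊆D b′∈B) (C⊆E c∈C) (C⊆E c′∈C) P-bc b′≢b c′≢c
           (λ { (x , x∈) (y , y∈) x≡ y≡ Pxy →
             let x∈B = within b∈B b′∈B x≡
                 y∈C = within c∈C c′∈C y≡
                 bc≡xy = unique-bc {(x , x∈B) , (y , y∈C)}
                   (trans (cong₂ P (Elem-≡ refl) (Elem-≡ refl)) Pxy)
             in sym (cong (λ t → proj₁ (proj₁ t)) bc≡xy) , sym (cong (λ t → proj₁ (proj₂ t)) bc≡xy) })
           ε ε<1 Iε sparse))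
    where
    open CompleteBipartite N
    within : ∀ {k} {S : Subset k} {x y z} → y Subset.∈ S → z Subset.∈ S → x ≡ y ⊎ x ≡ z → x Subset.∈ S
    within y∈ z∈ (inj₁ refl) = y∈
    within y∈ z∈ (inj₂ refl) = z∈

  dense-instance : ∀ {k} {D E : Subset k} (P : Predicate D E) → HasSingletonRestriction P →
    ∀ ε → ε <ᴿ 1ᴿ → ∀ N → ∃ λ n → N ℕ.≤ n × Σ (Instance n) λ I →
      ∀ (Iε : Instance n) → IsSparsifier P ε I Iε →
        fromℚ (½ * ½) *ᴿ (fromℕ n *ᴿ fromℕ n) ≤ᴿ fromℕ (#constraints Iε)
  dense-instance P has-singleton ε ε<1 N =
    N ℕ.+ N , ℕ.m≤m+n N N , CompleteBipartite.complete N , λ Iε sparse δ′ 0<δ′ → 0 , λ _ _ →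
      ℚ.≤-trans (ℚ.≤-reflexive quarter)
        (ℚ.≤-trans (toℚ-mono (quadratic-lower-bound P has-singleton ε ε<1 N Iε sparse))
          (≤-by δ′ (ℚ.<⇒≤ 0<δ′) refl))
    where
    quarter : ½ * ½ * (toℚ (N ℕ.+ N) * toℚ (N ℕ.+ N)) ≡ toℚ (N ℕ.* N)
    quarter = trans (cong (λ x → ½ * ½ * (x * x)) (toℚ-+ N N))
      (trans (q (toℚ N)) (sym (toℚ-* N N)))
      where
      q : ∀ x → ½ * ½ * ((x + x) * (x + x)) ≡ x * x
      q = solve-∀ ℚ-ring

  quarter-pos : 0ᴿ <ᴿ fromℚ (½ * ½)
  quarter-pos = ½ * ½ , ℚ.positive⁻¹ (½ * ½) , 0 , λ _ _ → ℚ.≤-reflexive (ℚ.+-identityˡ (½ * ½))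

open import Data.Fin.Subset using (∣_∣)
open import Data.Nat.Base using (_≤_)

theorem10 :
  ∀ {k : ℕ} (D E : Subset k) → 2 ≤ ∣ D ∣ → 2 ≤ ∣ E ∣ → (P : Predicate D E) →
    (HasSingletonRestriction P →
      ∃ λ (c : ℝ) → 0ᴿ <ᴿ c ×
        (∀ (ε : ℝ) → 0ᴿ <ᴿ ε → ε <ᴿ 1ᴿ →
         ∀ (N : ℕ) → ∃ λ (n : ℕ) → N ≤ n × Σ (Instance n) λ I →
           ∀ (Iε : Instance n) → IsSparsifier P ε I Iε →
             c *ᴿ (fromℕ n *ᴿ fromℕ n) ≤ᴿ fromℕ (#constraints Iε)))
    ×
    -- the bound is C ε⁻² n, multiplied through by ε² > 0
    (¬ HasSingletonRestriction P →
      ∃ λ (C : ℝ) →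
        ∀ (ε : ℝ) → 0ᴿ <ᴿ ε → ε <ᴿ 1ᴿ →
        ∀ (n : ℕ) (I : Instance n) → Σ (Instance n) λ Iε →
          IsSparsifier P ε I Iε ×
          fromℕ (#constraints Iε) *ᴿ (ε *ᴿ ε) ≤ᴿ C *ᴿ fromℕ n)
theorem10 D E _ _ P =
  (λ has-singleton → fromℚ (½ * ½) , quarter-pos , λ ε _ ε<1 → dense-instance P has-singleton ε ε<1) ,
  (λ no-singleton → fromℕ 1400 , linear-sparsifier P no-singleton)
  where
  open import Data.Rational.Base using (½; _*_)
  open LinearSparsifier
  open QuadraticLowerBound
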